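{- For every non-negative integer $n$, $$Q_5(5n+4)\equiv 0 \pmod 5,\qquad Q_7(7n+5)\equiv 0 \pmod 7,\qquad Q_{11}(11n+6)\equiv 0 \pmod{11}.$$
   Context: A partition of a positive integer $m$ is a non-increasing sequence of positive integers (its parts) summing to $m$. For positive integers $k,m$, $Q_k(m)$ denotes the total number of occurrences of the part $k$ among all partitions of $m$ (a partition in which $k$ appears $t$ times contributes $t$). -}

module Defs where

open import Data.List using (List; []; _∷_; _++_; map; filter; length)
open import Data.List.Membership.Propositional using (_∈_)
open import Data.List.Membership.Propositional.Properties
  using (∈-map⁺; ∈-map⁻; ∈-++⁺ˡ; ∈-++⁺ʳ; ∈-filter⁺; ∈-filter⁻)
open import Data.List.Relation.Binary.Disjoint.Propositional using (Disjoint)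
open import Data.List.Relation.Unary.All as All using (All; []; _∷_)
import Data.List.Relation.Unary.All.Properties as All
open import Data.List.Relation.Unary.AllPairs using ([]; _∷_)
open import Data.List.Relation.Unary.Any using (here)
open import Data.List.Relation.Unary.Linked using (Linked; linked?)
open import Data.List.Relation.Unary.Unique.Propositional using (Unique)
import Data.List.Relation.Unary.Unique.Propositional.Properties as Unique
open import Data.Nat using (ℕ; zero; suc; _+_; _≥_; _>_; z≤n; s≤s; _≟_; _≥?_)
open import Data.Nat.Properties using (suc-injective)
open import Data.Nat.ListAction using (sum)
open import Data.Product using (_×_; _,_)
open import Function.Bundles using (_⇔_; mk⇔)
open import Relation.Binary.PropositionalEquality using (_≡_; refl; cong)

record IsPartition (m : ℕ) (ps : List ℕ) : Set where
  constructor isPartition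
  field
    nonIncreasing : Linked _≥_ ps
    positive      : All (_> 0) ps
    sums          : sum ps ≡ m

-- The empty list is a junk case: `bump` is only ever used on non-empty lists.
bump : List ℕ → List ℕ
bump []       = []
bump (p ∷ ps) = suc p ∷ ps

-- All finite sequences of positive integers with sum m: a composition of
-- m + 2 is obtained from one of m + 1 either by putting a 1 in front (first
-- entry 1) or by increasing the first entry (first entry at least 2).
compositions : ℕ → List (List ℕ)
compositions zero          = [] ∷ []
compositions (suc zero)    = (1 ∷ []) ∷ []
compositions (suc (suc m)) =
  map (1 ∷_) (compositions (suc m)) ++ map bump (compositions (suc m))

-- The partitions of m, each listed exactly once; see `∈-partitions` and
-- `partitions-unique` below.
partitions : ℕ → List (List ℕ)
partitions m = filter (linked? _≥?_) (compositions m)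

occurrences : ℕ → List ℕ → ℕ
occurrences k ps = length (filter (k ≟_) ps)

Q : ℕ → ℕ → ℕ
Q k m = sum (map (occurrences k) (partitions m))

compositions-sound : ∀ m → All (λ ps → All (_> 0) ps × sum ps ≡ m) (compositions m)
compositions-sound zero          = ([] , refl) ∷ []
compositions-sound (suc zero)    = (s≤s z≤n ∷ [] , refl) ∷ []
compositions-sound (suc (suc m)) =
  All.++⁺ (All.map⁺ (All.map prepend (compositions-sound (suc m))))
          (All.map⁺ (All.map increase (compositions-sound (suc m))))
  where
  prepend : ∀ {ps} → All (_> 0) ps × sum ps ≡ suc m →
            All (_> 0) (1 ∷ ps) × sum (1 ∷ ps) ≡ suc (suc m)
  prepend (pos , eq) = s≤s z≤n ∷ pos , cong suc eq

  increase : ∀ {ps} → All (_> 0) ps × sum ps ≡ suc m →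
             All (_> 0) (bump ps) × sum (bump ps) ≡ suc (suc m)
  increase {_ ∷ _} (_ ∷ pos , eq) = s≤s z≤n ∷ pos , cong suc eq

∈-compositions⁻ : ∀ m {ps} → ps ∈ compositions m → All (_> 0) ps × sum ps ≡ m
∈-compositions⁻ m = All.lookup (compositions-sound m)

∈-compositions⁺ : ∀ m {ps} → All (_> 0) ps → sum ps ≡ m → ps ∈ compositions m
∈-compositions⁺ zero       {[]}               _           _  = here refl
∈-compositions⁺ zero       {zero ∷ _}         (() ∷ _)    _
∈-compositions⁺ (suc _)    {zero ∷ _}         (() ∷ _)    _
∈-compositions⁺ (suc zero) {1 ∷ []}           _           _  = here refl
∈-compositions⁺ (suc zero) {1 ∷ zero ∷ _}     (_ ∷ () ∷ _) _
∈-compositions⁺ (suc (suc m)) {1 ∷ ps}        (_ ∷ pos)   eq =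
  ∈-++⁺ˡ (∈-map⁺ (1 ∷_) (∈-compositions⁺ (suc m) pos (suc-injective eq)))
∈-compositions⁺ (suc (suc m)) {suc (suc p) ∷ ps} (_ ∷ pos) eq =
  ∈-++⁺ʳ (map (1 ∷_) (compositions (suc m)))
    (∈-map⁺ bump
      (∈-compositions⁺ (suc m) {suc p ∷ ps} (s≤s z≤n ∷ pos) (suc-injective eq)))

bump-injective : ∀ {ps qs} → bump ps ≡ bump qs → ps ≡ qs
bump-injective {[]}    {[]}    _    = refl
bump-injective {_ ∷ _} {_ ∷ _} refl = refl

compositions-unique : ∀ m → Unique (compositions m)
compositions-unique zero          = [] ∷ []
compositions-unique (suc zero)    = [] ∷ []
compositions-unique (suc (suc m)) =
  Unique.++⁺ (Unique.map⁺ (λ { refl → refl }) (compositions-unique (suc m)))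
             (Unique.map⁺ bump-injective (compositions-unique (suc m)))
             disjoint
  where
  disjoint : Disjoint (map (1 ∷_) (compositions (suc m)))
                      (map bump (compositions (suc m)))
  disjoint (ps∈₁ , ps∈₂) with ∈-map⁻ (1 ∷_) ps∈₁ | ∈-map⁻ bump ps∈₂
  ... | _ , _ , refl | zero ∷ _ , qs∈ , refl with ∈-compositions⁻ (suc m) qs∈
  ...   | () ∷ _ , _

∈-partitions : ∀ m {ps} → ps ∈ partitions m ⇔ IsPartition m ps
∈-partitions m {ps} = mk⇔ to from
  where
  to : ps ∈ partitions m → IsPartition m ps
  to ps∈ with ∈-filter⁻ (linked? _≥?_) {xs = compositions m} ps∈
  ... | ps∈′ , dec with ∈-compositions⁻ m ps∈′
  ...   | pos , eq = isPartition dec pos eq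

  from : IsPartition m ps → ps ∈ partitions m
  from (isPartition dec pos eq) =
    ∈-filter⁺ (linked? _≥?_) (∈-compositions⁺ m pos eq) dec

partitions-unique : ∀ m → Unique (partitions m)
partitions-unique m = Unique.filter⁺ (linked? _≥?_) (compositions-unique m)

{-# OPTIONS --safe #-}
module Submission where

-- Q_p(m + p) exceeds Q_p(m) by the number of partitions of m, so it suffices to prove Ramanujan's
-- congruences for the partition function.  Let E = ∏ (1 - q^i), so that 1/E generates the
-- partitions, and let J = E³ = Σ (-1)^k (2k+1) q^(k(k+1)/2) (Jacobi).
-- Modulo p the series F = E^p is a series in q^p, and 1/E is, up to a power of F, equal to J³, J²
-- or J⁷ for p = 5, 7 or 11.  The exponents k(k+1)/2 with p ∤ 2k+1 miss many classes modulo p, and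
-- for p = 5 and 7 this already excludes the class 4 of J³ and the class 5 of J².
-- For p = 11 (following Hirschhorn), J⁴ = F E, and by Euler's pentagonal number theorem E has no
-- exponents in the classes 3, 6, 8, 9, 10.  These are five quartic relations between the five
-- components of J, and the class 6 of J⁷ is a combination of them.

open import Defs
open import Algebra.Bundles using (CommutativeRing)
import Algebra.Properties.CommutativeSemigroup as CommutativeSemigroupProperties
import Algebra.Properties.CommutativeSemiring.Exp as CommutativeExp
import Algebra.Properties.Ring as RingProperties
import Algebra.Properties.Semiring.Exp as Exp
import Algebra.Solver.Ring as RingSolver
open import Algebra.Solver.Ring.AlmostCommutativeRing
  using (fromCommutativeRing; _-Raw-AlmostCommutative⟶_; Induced-equivalence)
open import Data.Bool using (T; if_then_else_; true; false)
open import Data.Empty using (⊥-elim)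
open import Data.Integer as ℤ using (ℤ; +_)
open import Data.Integer.Divisibility.Signed as ℤ∣
  using (divides; ∣m∣n⇒∣m+n; ∣m⇒∣-m; ∣m⇒∣m*n; ∣n⇒∣m*n; ∣⇒∣ᵤ)
import Data.Integer.Properties as ℤ
open import Data.Integer.Tactic.RingSolver using (solve-∀)
open import Data.List using (List; []; _∷_; _++_; map; filter; length)
open import Data.List.Membership.Propositional using (_∈_)
open import Data.List.Membership.Propositional.Properties
  using (∈-map⁺; ∈-map⁻; ∈-++⁺ˡ; ∈-++⁺ʳ; ∈-++⁻; ∈-filter⁺; ∈-filter⁻)
open import Data.List.Membership.Propositional.Properties.WithK using (unique∧set⇒bag)
import Data.List.Properties as List
open import Data.List.Relation.Binary.BagAndSetEquality using (∼bag⇒↭)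
open import Data.List.Relation.Binary.Permutation.Propositional using (_↭_)
import Data.List.Relation.Binary.Permutation.Propositional.Properties as ↭
open import Data.List.Relation.Unary.All as All using (All; []; _∷_; all?)
open import Data.List.Relation.Unary.AllPairs using ([])
open import Data.List.Relation.Unary.Any using (here; there)
open import Data.List.Relation.Unary.Linked as Linked using (Linked; []; [-]; _∷_)
open import Data.List.Relation.Unary.Linked.Properties using (Linked⇒All)
open import Data.List.Relation.Unary.Unique.Propositional using (Unique)
import Data.List.Relation.Unary.Unique.Propositional.Properties as Unique
open import Data.Maybe using (just; nothing)
open import Data.Nat as ℕ using (ℕ; zero; suc; _≤_; _<_; _≥_; z≤n; s≤s; _≟_; _≤?_; _≡ᵇ_)
open import Data.Nat.DivMod
  using (_%_; _/_; %-distribˡ-+; [m+n]%n≡m%n; [m+kn]%n≡m%n; m%n<n; m%n%n≡m%n; m<n⇒m%n≡m; m≡m%n+[m/n]*n)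
open import Data.Nat.Divisibility using (_∣_)
open import Data.Nat.ListAction using (sum)
open import Data.Nat.ListAction.Properties using (sum-++; sum-↭)
import Data.Nat.Properties as ℕ
open import Data.Nat.Solver using (module +-*-Solver)
open import Data.List.Membership.DecPropositional _≟_ using (_∈?_)
open import Data.Product using (_×_; _,_; ∃; proj₁; proj₂)
open import Data.Sum using (_⊎_; inj₁; inj₂)
open import Data.Unit using (tt)
open import Function.Bundles using (mk⇔; Equivalence)
open import Level using (0ℓ)
open import Relation.Binary.Definitions using (WeaklyDecidable)
open import Relation.Binary.PropositionalEquality as ≡ using (_≡_; _≢_)
import Relation.Binary.Reasoning.Setoid as SetoidReasoning
open import Relation.Nullary using (¬_; Dec; yes; no; does)
open import Relation.Nullary.Decidable as Dec
  using (dec-true; dec-false; True; False; toWitness; toWitnessFalse; from-yes; _⊎-dec_; _×-dec_)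

-- Since 8 · k(k+1)/2 + 1 = (2k+1)², an exponent n of J whose coefficient is nonzero modulo p makes
-- 8n + 1 a nonzero square. The classes t = 4, 5, 6 solve 24 t ≡ 1, and in the powers J³, J², J⁷
-- they require 3, 2 or 7 nonzero squares with sum 0. Three values ±1 never have sum 0 modulo 5, nor
-- do two nonzero squares modulo 7, where -1 is not a square. Seven nonzero squares modulo 11 can
-- have sum 0, hence the extra input from E. All series live in K[[q]]/(q^N), with N just above the
-- exponent in question. There q^N = 0 makes infinite products and sums finite, and the identities
-- of Euler and Jacobi follow from finite identities valid in every commutative ring; Jacobi's also
-- cancels E, by means of its inverse, the generating function of the partitions. Polynomial
-- identities are left to a ring solver that compares integer coefficients modulo p; it proves (1 -
-- x)^p = 1 - x^p as well as the degree-seven identity for p = 11.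

ℤ⟶_ : CommutativeRing 0ℓ 0ℓ → Set
ℤ⟶ R = ℤ.+-*-rawRing -Raw-AlmostCommutative⟶ fromCommutativeRing R

Kills : ∀ {R} → ℤ⟶ R → ℕ → Set
Kills {R} ι n = ⟦ + n ⟧ ≈ 0#
  where
  open CommutativeRing R
  open _-Raw-AlmostCommutative⟶_ ι

-- Solver coefficients modulo p

module IntegerCoefficients
  (R : CommutativeRing 0ℓ 0ℓ)
  (ι : ℤ⟶ R)
  (p : ℕ)
  (p≈0 : Kills ι p)
  where

  open CommutativeRing R
  open _-Raw-AlmostCommutative⟶_ ι
  open SetoidReasoning setoid

  -- Coefficients that differ by a multiple of `p` count as equal, so normal forms lose every
  -- coefficient divisible by `p`. For `p = 0` this is plain equality, and the solver serves every
  -- commutative ring.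
  _coeff≟_ : WeaklyDecidable (Induced-equivalence ι)
  c coeff≟ d with + p ℤ∣.∣? c ℤ.- d
  ... | no  _                  = nothing
  ... | yes (divides k c-d≡kp) = just (begin
    ⟦ c ⟧                          ≈⟨ reflexive (≡.cong ⟦_⟧ (c≡c-d+d)) ⟩
    ⟦ c ℤ.- d ℤ.+ d ⟧              ≈⟨ +-homo (c ℤ.- d) d ⟩
    ⟦ c ℤ.- d ⟧ + ⟦ d ⟧            ≈⟨ +-congʳ (reflexive (≡.cong ⟦_⟧ c-d≡kp)) ⟩
    ⟦ k ℤ.* + p ⟧ + ⟦ d ⟧          ≈⟨ +-congʳ (trans (*-homo k (+ p)) (trans (*-congˡ p≈0) (zeroʳ ⟦ k ⟧))) ⟩
    0# + ⟦ d ⟧                     ≈⟨ +-identityˡ ⟦ d ⟧ ⟩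
    ⟦ d ⟧                          ∎)
    where
    c≡c-d+d : c ≡ c ℤ.- d ℤ.+ d
    c≡c-d+d = ≡.sym (≡.trans (ℤ.+-assoc c (ℤ.- d) d)
      (≡.trans (≡.cong (λ x → c ℤ.+ x) (ℤ.+-inverseˡ d)) (ℤ.+-identityʳ c)))

∑≤ : ∀ {A : Set} → (A → A → A) → ℕ → (ℕ → A) → A
∑≤ _+_ zero    f = f 0
∑≤ _+_ (suc n) f = ∑≤ _+_ n f + f (suc n)

-- The class `t` of a product in terms of the classes of its factors; `suc p-1 ∸ s` stands for -s.
-- The operations are arguments so that the same formula can be formed from ring elements and from
-- solver polynomials.
cyclic : ∀ {A : Set} → (A → A → A) → (A → A → A) → ℕ → (ℕ → A) → (ℕ → A) → ℕ → A
cyclic _+_ _*_ p-1 u v t = ∑≤ _+_ p-1 (λ s → u s * v ((t ℕ.+ (suc p-1 ℕ.∸ s)) % suc p-1))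

-- The integers modulo p

module Residues (p : ℕ) where

  infix 4 _≈ₚ_

  record _≈ₚ_ (x y : ℤ) : Set where
    constructor congruent
    field difference : + p ℤ∣.∣ x ℤ.- y

  private
    reflexive : ∀ {x y} → x ≡ y → x ≈ₚ y
    reflexive {x} ≡.refl = congruent (divides (+ 0) (ℤ.+-inverseʳ x))

    sym : ∀ {x y} → x ≈ₚ y → y ≈ₚ x
    sym {x} {y} (congruent d) =
      congruent (≡.subst (+ p ℤ∣.∣_) (flip x y) (∣m⇒∣-m d))
      where
      flip : ∀ x y → ℤ.- (x ℤ.- y) ≡ y ℤ.- x
      flip = solve-∀

    trans : ∀ {x y z} → x ≈ₚ y → y ≈ₚ z → x ≈ₚ z
    trans {x} {y} {z} (congruent d) (congruent e) =
      congruent (≡.subst (+ p ℤ∣.∣_) (telescope x y z) (∣m∣n⇒∣m+n d e))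
      where
      telescope : ∀ x y z → x ℤ.- y ℤ.+ (y ℤ.- z) ≡ x ℤ.- z
      telescope = solve-∀

    +-cong : ∀ {x y u v} → x ≈ₚ y → u ≈ₚ v → x ℤ.+ u ≈ₚ y ℤ.+ v
    +-cong {x} {y} {u} {v} (congruent d) (congruent e) =
      congruent (≡.subst (+ p ℤ∣.∣_) (regroup x y u v) (∣m∣n⇒∣m+n d e))
      where
      regroup : ∀ x y u v → x ℤ.- y ℤ.+ (u ℤ.- v) ≡ x ℤ.+ u ℤ.- (y ℤ.+ v)
      regroup = solve-∀

    *-cong : ∀ {x y u v} → x ≈ₚ y → u ≈ₚ v → x ℤ.* u ≈ₚ y ℤ.* v
    *-cong {x} {y} {u} {v} (congruent d) (congruent e) =
      congruent (≡.subst (+ p ℤ∣.∣_) (regroup x y u v)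
        (∣m∣n⇒∣m+n (∣m⇒∣m*n u d) (∣n⇒∣m*n y e)))
      where
      regroup : ∀ x y u v →
                (x ℤ.- y) ℤ.* u ℤ.+ y ℤ.* (u ℤ.- v) ≡ x ℤ.* u ℤ.- y ℤ.* v
      regroup = solve-∀

    -‿cong : ∀ {x y} → x ≈ₚ y → ℤ.- x ≈ₚ ℤ.- y
    -‿cong {x} {y} (congruent d) =
      congruent (≡.subst (+ p ℤ∣.∣_) (regroup x y) (∣m⇒∣-m d))
      where
      regroup : ∀ x y → ℤ.- (x ℤ.- y) ≡ ℤ.- x ℤ.- ℤ.- y
      regroup = solve-∀

  ℤ/p : CommutativeRing 0ℓ 0ℓ
  ℤ/p = record
    { Carrier = ℤ ; _≈_ = _≈ₚ_ ; _+_ = ℤ._+_ ; _*_ = ℤ._*_ ; -_ = ℤ.-_ ; 0# = + 0 ; 1# = + 1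
    ; isCommutativeRing = record
      { isRing = record
        { +-isAbelianGroup = record
          { isGroup = record
            { isMonoid = record
              { isSemigroup = record
                { isMagma = record
                  { isEquivalence = record
                    { refl = reflexive ≡.refl ; sym = sym ; trans = trans }
                  ; ∙-cong = +-cong }
                ; assoc = λ x y z → reflexive (ℤ.+-assoc x y z) }
              ; identity = (λ x → reflexive (ℤ.+-identityˡ x)) , (λ x → reflexive (ℤ.+-identityʳ x)) }
            ; inverse = (λ x → reflexive (ℤ.+-inverseˡ x)) , (λ x → reflexive (ℤ.+-inverseʳ x))
            ; ⁻¹-cong = -‿cong }
          ; comm = λ x y → reflexive (ℤ.+-comm x y) }
        ; *-cong = *-cong
        ; *-assoc = λ x y z → reflexive (ℤ.*-assoc x y z)
        ; *-identity = (λ x → reflexive (ℤ.*-identityˡ x)) , (λ x → reflexive (ℤ.*-identityʳ x))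
        ; distrib = (λ x y z → reflexive (ℤ.*-distribˡ-+ x y z)) , (λ x y z → reflexive (ℤ.*-distribʳ-+ x y z))
        }
      ; *-comm = λ x y → reflexive (ℤ.*-comm x y)
      }
    }

  integers : ℤ⟶ ℤ/p
  integers = record
    { ⟦_⟧    = λ c → c
    ; +-homo = λ _ _ → reflexive ≡.refl
    ; *-homo = λ _ _ → reflexive ≡.refl
    ; -‿homo = λ _ → reflexive ≡.refl
    ; 0-homo = reflexive ≡.refl
    ; 1-homo = reflexive ≡.refl
    }

  p≈0 : + p ≈ₚ + 0
  p≈0 = congruent (≡.subst (+ p ℤ∣.∣_) (≡.sym (ℤ.+-identityʳ (+ p))) ℤ∣.∣-refl)

-- Truncated power series

module Convolution (K : CommutativeRing 0ℓ 0ℓ) where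

  private
    module K = CommutativeRing K
    open K using (_≈_; _+_; _*_; 0#; 1#)
    open CommutativeSemigroupProperties K.+-commutativeSemigroup
      using () renaming (interchange to +-interchange)
    open import Relation.Binary.Reasoning.Setoid K.setoid

  Series : Set
  Series = ℕ → K.Carrier

  infixl 7 _⊛_
  _⊛_ : Series → Series → Series
  (f ⊛ g) zero    = f 0 * g 0
  (f ⊛ g) (suc n) = f 0 * g (suc n) + ((λ m → f (suc m)) ⊛ g) n

  const : K.Carrier → Series
  const c zero    = c
  const c (suc _) = 0#

  shift : Series → Series
  shift f zero    = 0#
  shift f (suc n) = f n

  -- The restriction to `i + j ≡ n` is what lets truncation at N and residue classes of exponents
  -- enter later.
  ⊛-cong : ∀ {f f′ g g′} n → (∀ i j → i ℕ.+ j ≡ n → f i * g j ≈ f′ i * g′ j) →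
           (f ⊛ g) n ≈ (f′ ⊛ g′) n
  ⊛-cong zero    eq = eq 0 0 ≡.refl
  ⊛-cong (suc n) eq =
    K.+-cong (eq 0 (suc n) ≡.refl) (⊛-cong n (λ i j i+j≡n → eq (suc i) j (≡.cong suc i+j≡n)))

  ⊛-zero : ∀ {f g} n → (∀ i j → i ℕ.+ j ≡ n → f i * g j ≈ 0#) → (f ⊛ g) n ≈ 0#
  ⊛-zero zero    eq = eq 0 0 ≡.refl
  ⊛-zero (suc n) eq = K.trans
    (K.+-cong (eq 0 (suc n) ≡.refl) (⊛-zero n (λ i j i+j≡n → eq (suc i) j (≡.cong suc i+j≡n))))
    (K.+-identityˡ 0#)

  ⊛-sucʳ : ∀ f g n → (f ⊛ g) (suc n) ≈ (f ⊛ (λ m → g (suc m))) n + f (suc n) * g 0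
  ⊛-sucʳ f g zero    = K.refl
  ⊛-sucʳ f g (suc n) = K.trans (K.+-congˡ (⊛-sucʳ (λ m → f (suc m)) g n)) (K.sym (K.+-assoc _ _ _))

  ⊛-comm : ∀ f g n → (f ⊛ g) n ≈ (g ⊛ f) n
  ⊛-comm f g zero    = K.*-comm _ _
  ⊛-comm f g (suc n) = begin
    f 0 * g (suc n) + ((λ m → f (suc m)) ⊛ g) n  ≈⟨ K.+-cong (K.*-comm _ _) (⊛-comm _ g n) ⟩
    g (suc n) * f 0 + (g ⊛ (λ m → f (suc m))) n  ≈⟨ K.+-comm _ _ ⟩
    (g ⊛ (λ m → f (suc m))) n + g (suc n) * f 0  ≈⟨ ⊛-sucʳ g f n ⟨
    (g ⊛ f) (suc n)                              ∎

  ⊛-distribʳ : ∀ h f g n → ((λ m → f m + g m) ⊛ h) n ≈ (f ⊛ h) n + (g ⊛ h) n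
  ⊛-distribʳ h f g zero    = K.distribʳ _ _ _
  ⊛-distribʳ h f g (suc n) = K.trans
    (K.+-cong (K.distribʳ _ _ _) (⊛-distribʳ h _ _ n)) (+-interchange _ _ _ _)

  ⊛-scaleˡ : ∀ c f g n → ((λ m → c * f m) ⊛ g) n ≈ c * (f ⊛ g) n
  ⊛-scaleˡ c f g zero    = K.*-assoc _ _ _
  ⊛-scaleˡ c f g (suc n) = K.trans
    (K.+-cong (K.*-assoc _ _ _) (⊛-scaleˡ c _ g n)) (K.sym (K.distribˡ _ _ _))

  ⊛-assoc : ∀ f g h n → ((f ⊛ g) ⊛ h) n ≈ (f ⊛ (g ⊛ h)) n
  ⊛-assoc f g h zero    = K.*-assoc _ _ _
  ⊛-assoc f g h (suc n) = begin
    f 0 * g 0 * h (suc n) + ((λ m → f 0 * g (suc m) + (f₊ ⊛ g) m) ⊛ h) n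
      ≈⟨ K.+-cong (K.*-assoc _ _ _) (⊛-distribʳ h _ _ n) ⟩
    f 0 * (g 0 * h (suc n)) + (((λ m → f 0 * g₊ m) ⊛ h) n + ((f₊ ⊛ g) ⊛ h) n)
      ≈⟨ K.+-congˡ (K.+-cong (⊛-scaleˡ (f 0) g₊ h n) (⊛-assoc f₊ g h n)) ⟩
    f 0 * (g 0 * h (suc n)) + (f 0 * (g₊ ⊛ h) n + (f₊ ⊛ (g ⊛ h)) n)
      ≈⟨ K.+-assoc _ _ _ ⟨
    f 0 * (g 0 * h (suc n)) + f 0 * (g₊ ⊛ h) n + (f₊ ⊛ (g ⊛ h)) n
      ≈⟨ K.+-congʳ (K.distribˡ _ _ _) ⟨
    f 0 * (g ⊛ h) (suc n) + (f₊ ⊛ (g ⊛ h)) n  ∎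
    where
    f₊ g₊ : Series
    f₊ m = f (suc m)
    g₊ m = g (suc m)

  const-⊛ : ∀ c f n → (const c ⊛ f) n ≈ c * f n
  const-⊛ c f zero    = K.refl
  const-⊛ c f (suc n) =
    K.trans (K.+-congˡ (⊛-zero n (λ _ _ _ → K.zeroˡ _))) (K.+-identityʳ _)

  shift-⊛ : ∀ f g n → (shift f ⊛ g) n ≈ shift (f ⊛ g) n
  shift-⊛ f g zero    = K.zeroˡ _
  shift-⊛ f g (suc n) = K.trans (K.+-congʳ (K.zeroˡ _)) (K.+-identityˡ _)

-- The ring K[[q]]/(q^N).
module Truncated (K : CommutativeRing 0ℓ 0ℓ) (N : ℕ) where

  private module K = CommutativeRing K
  open Convolution K public

  infix 4 _≋_
  _≋_ : Series → Series → Set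
  f ≋ g = ∀ n → n < N → f n K.≈ g n

  ⊛-≋-cong : ∀ {f f′ g g′} → f ≋ f′ → g ≋ g′ → f ⊛ g ≋ f′ ⊛ g′
  ⊛-≋-cong f≋f′ g≋g′ n n<N = ⊛-cong n λ { i j ≡.refl → K.*-cong
    (f≋f′ i (ℕ.≤-<-trans (ℕ.m≤m+n i j) n<N)) (g≋g′ j (ℕ.≤-<-trans (ℕ.m≤n+m j i) n<N)) }

  ⊛-identityˡ : ∀ f → const K.1# ⊛ f ≋ f
  ⊛-identityˡ f n _ = K.trans (const-⊛ K.1# f n) (K.*-identityˡ _)

  seriesRing : CommutativeRing 0ℓ 0ℓ
  seriesRing = record
    { Carrier = Series ; _≈_ = _≋_ ; _+_ = λ f g n → f n K.+ g n ; _*_ = _⊛_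
    ; -_ = λ f n → K.- f n ; 0# = λ _ → K.0# ; 1# = const K.1#
    ; isCommutativeRing = record
      { isRing = record
        { +-isAbelianGroup = record
          { isGroup = record
            { isMonoid = record
              { isSemigroup = record
                { isMagma = record
                  { isEquivalence = record
                    { refl = λ _ _ → K.refl
                    ; sym = λ f≋g n n<N → K.sym (f≋g n n<N)
                    ; trans = λ f≋g g≋h n n<N → K.trans (f≋g n n<N) (g≋h n n<N) }
                  ; ∙-cong = λ f≋g h≋k n n<N → K.+-cong (f≋g n n<N) (h≋k n n<N) }
                ; assoc = λ f g h n _ → K.+-assoc (f n) (g n) (h n) }
              ; identity = (λ f n _ → K.+-identityˡ (f n)) , (λ f n _ → K.+-identityʳ (f n)) }
            ; inverse = (λ f n _ → K.-‿inverseˡ (f n)) , (λ f n _ → K.-‿inverseʳ (f n))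
            ; ⁻¹-cong = λ f≋g n n<N → K.-‿cong (f≋g n n<N) }
          ; comm = λ f g n _ → K.+-comm (f n) (g n) }
        ; *-cong = ⊛-≋-cong
        ; *-assoc = λ f g h n _ → ⊛-assoc f g h n
        ; *-identity = ⊛-identityˡ ,
            (λ f n n<N → K.trans (⊛-comm f (const K.1#) n) (⊛-identityˡ f n n<N))
        ; distrib = (λ f g h n _ → K.trans (⊛-comm f _ n) (K.trans (⊛-distribʳ f g h n)
                      (K.+-cong (⊛-comm g f n) (⊛-comm h f n)))) ,
                    (λ f g h n _ → ⊛-distribʳ f g h n)
        }
      ; *-comm = λ f g n _ → ⊛-comm f g n
      }
    }

  private module R = CommutativeRing seriesRing
  open Exp R.semiring using (_^_)

  q : Series
  q = shift R.1#

  q⊛ : ∀ f → q ⊛ f ≋ shift f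
  q⊛ f zero    _   = K.zeroˡ _
  q⊛ f (suc n) n<N = K.trans (shift-⊛ R.1# f (suc n)) (⊛-identityˡ f n (ℕ.<-trans (ℕ.n<1+n n) n<N))

  q^⊛-below : ∀ k f n → n < N → n < k → (q ^ k ⊛ f) n K.≈ K.0#
  q^⊛-below (suc k) f zero    n<N n<k = K.trans (R.*-assoc q (q ^ k) f 0 n<N) (K.zeroˡ _)
  q^⊛-below (suc k) f (suc n) n<N (s≤s n<k) =
    K.trans (R.*-assoc q (q ^ k) f (suc n) n<N)
      (K.trans (q⊛ (q ^ k ⊛ f) (suc n) n<N)
        (q^⊛-below k f n (ℕ.<-trans (ℕ.n<1+n n) n<N) n<k))

  q^⊛-above : ∀ k f n → k ℕ.+ n < N → (q ^ k ⊛ f) (k ℕ.+ n) K.≈ f n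
  q^⊛-above zero    f n n<N = ⊛-identityˡ f n n<N
  q^⊛-above (suc k) f n n<N =
    K.trans (R.*-assoc q (q ^ k) f (suc k ℕ.+ n) n<N)
      (K.trans (q⊛ (q ^ k ⊛ f) (suc k ℕ.+ n) n<N)
        (q^⊛-above k f n (ℕ.<-trans (ℕ.n<1+n _) n<N)))

  q^N≋0 : q ^ N ≋ R.0#
  q^N≋0 n n<N = K.trans (K.sym (R.*-identityʳ (q ^ N) n n<N)) (q^⊛-below N R.1# n n<N n<N)

  const-cong : ∀ {c d} → c K.≈ d → const c ≋ const d
  const-cong c≈d zero    _ = c≈d
  const-cong c≈d (suc n) _ = K.refl

  constants : ℤ⟶ K →
              ℤ⟶ seriesRing
  constants κ = record
    { ⟦_⟧    = λ c → const ⟦ c ⟧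
    ; +-homo = λ { c d zero _ → +-homo c d ; c d (suc n) _ → K.sym (K.+-identityˡ K.0#) }
    ; *-homo = λ { c d zero _ → *-homo c d
                 ; c d (suc n) _ → K.sym (K.trans (const-⊛ ⟦ c ⟧ (const ⟦ d ⟧) (suc n)) (K.zeroʳ ⟦ c ⟧)) }
    ; -‿homo = λ { c zero _ → -‿homo c ; c (suc n) _ → K.sym (RingProperties.-0#≈0# K.ring) }
    ; 0-homo = λ { zero _ → 0-homo ; (suc n) _ → K.refl }
    ; 1-homo = const-cong 1-homo
    }
    where open _-Raw-AlmostCommutative⟶_ κ

-- Finite forms of Jacobi's identity and of the pentagonal number theorem

module QSums (R : CommutativeRing 0ℓ 0ℓ) (q : CommutativeRing.Carrier R) where

  open CommutativeRing R hiding (zero)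
  open Exp semiring public using (_^_; ^-homo-*; ^-congˡ)

  ∑ : ℕ → (ℕ → Carrier) → Carrier
  ∑ = ∑≤ _+_

  eulerProduct : Carrier → ℕ → Carrier
  eulerProduct x zero    = 1#
  eulerProduct x (suc n) = eulerProduct x n * (1# - x ^ suc n)

  odd : ℕ → Carrier
  odd zero    = 1#
  odd (suc k) = odd k + (1# + 1#)

  -- (-1)^k q^(k(k+1)/2), given by the ratio of consecutive terms.
  alternating : ℕ → Carrier
  alternating zero    = 1#
  alternating (suc k) = - (q ^ suc k * alternating k)

  jacobiSum : ℕ → Carrier
  jacobiSum n = ∑ n (λ k → odd k * alternating k)

  -- (-1)^k q^(k(3k+1)/2); consecutive exponents differ by 3k + 2.
  pentagonal : ℕ → Carrier
  pentagonal zero    = 1#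
  pentagonal (suc k) = - (q ^ k * q ^ k * q ^ k * (q * q) * pentagonal k)

  -- The terms of Euler's series with the indices k and -k, taken together.
  pentagonalPair : ℕ → Carrier
  pentagonalPair zero    = 1#
  pentagonalPair (suc k) = pentagonal (suc k) - q ^ k * q ^ k * q * pentagonal k

  pentagonalSum : ℕ → Carrier
  pentagonalSum n = ∑ n pentagonalPair

module QSeries
  (R : CommutativeRing 0ℓ 0ℓ)
  (ι : ℤ⟶ R)
  (q : CommutativeRing.Carrier R)
  where

  private
    open module R = CommutativeRing R hiding (zero)
    open RingProperties ring using (-0#≈0#)
    open SetoidReasoning setoid
    open _-Raw-AlmostCommutative⟶_ ι using (0-homo)
    open RingSolver ℤ.+-*-rawRing (fromCommutativeRing R) ι (IntegerCoefficients._coeff≟_ R ι 0 0-homo)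
      using (solve; _:=_; Polynomial; con; _:+_; _:*_; _:-_; :-_; _:^_)

    -- A zeroth power evaluates to `1#` itself, whereas `con (+ 1)` evaluates to the image of 1
    -- under `ι`, which is equal to `1#` only up to `≈`.
    𝟙 : ∀ {n} → Polynomial n
    𝟙 = con (+ 0) :^ 0
  open QSums R q
  ∑-cong : ∀ {f g} n → (∀ k → f k ≈ g k) → ∑ n f ≈ ∑ n g
  ∑-cong zero    f≈g = f≈g 0
  ∑-cong (suc n) f≈g = +-cong (∑-cong n f≈g) (f≈g (suc n))

  *-distribˡ-∑ : ∀ c f n → ∑ n (λ k → c * f k) ≈ c * ∑ n f
  *-distribˡ-∑ c f zero    = refl
  *-distribˡ-∑ c f (suc n) = trans (+-congʳ (*-distribˡ-∑ c f n)) (sym (distribˡ c _ _))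

  -- The coefficient of z^k in
  --   (1 - z⁻¹) ∏_{1 ≤ i ≤ n} (1 - z q^i) (1 - z⁻¹ q^i),
  -- for k ≥ 0; the coefficient of z^(-1-k) is its negative.
  theta : ℕ → ℕ → Carrier
  theta zero    zero    = 1#
  theta zero    (suc k) = 0#
  theta (suc n) zero    = (1# + Qₙ * Qₙ + Qₙ) * theta n 0 - Qₙ * theta n 1
    where Qₙ = q ^ suc n
  theta (suc n) (suc k) = (1# + Qₙ * Qₙ) * theta n (suc k) - Qₙ * (theta n k + theta n (2 ℕ.+ k))
    where Qₙ = q ^ suc n

  theta-vanishes : ∀ n k → n < k → theta n k ≈ 0#
  theta-vanishes zero    (suc k) _         = refl
  theta-vanishes (suc n) (suc k) (s≤s n<k) = begin
    (1# + Qₙ * Qₙ) * theta n (suc k) - Qₙ * (theta n k + theta n (2 ℕ.+ k))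
      ≈⟨ +-cong (*-congˡ (theta-vanishes n (suc k) (ℕ.m<n⇒m<1+n n<k)))
           (-‿cong (*-congˡ (+-cong (theta-vanishes n k n<k)
             (theta-vanishes n (2 ℕ.+ k) (ℕ.m<n⇒m<1+n (ℕ.m<n⇒m<1+n n<k)))))) ⟩
    (1# + Qₙ * Qₙ) * 0# - Qₙ * (0# + 0#)
      ≈⟨ +-cong (zeroʳ _) (-‿cong (trans (*-congˡ (+-identityˡ 0#)) (zeroʳ Qₙ))) ⟩
    0# - 0#  ≈⟨ -‿inverseʳ 0# ⟩
    0#       ∎
    where Qₙ = q ^ suc n

  -- Comparing coefficients of z^(k+1) in the functional equation of the
  -- product under z ↦ q z.
  thetaDefect : ℕ → ℕ → Carrier
  thetaDefect n k =
    theta n (suc k) * (1# - q ^ n * q ^ (2 ℕ.+ k)) + (q ^ suc k - q ^ suc n) * theta n k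

  -- Induction on `n`: the new factors 1 - z q^(n+1) and 1 - z⁻¹ q^(n+1) make the defect at `k` a
  -- combination of the old defects at `k - 1`, `k` and `k + 1`. For `k = 0` the one at -1 is
  -- absent: it vanishes because the coefficients at z⁻¹ and z⁰ are opposite.
  thetaDefect≈0 : ∀ n k → thetaDefect n k ≈ 0#
  thetaDefect≈0 zero zero    = trans (+-cong (zeroˡ _) (trans (*-congʳ (-‿inverseʳ _)) (zeroˡ _))) (+-identityˡ 0#)
  thetaDefect≈0 zero (suc k) = trans (+-cong (zeroˡ _) (zeroʳ _)) (+-identityˡ 0#)
  thetaDefect≈0 (suc n) zero = begin
    thetaDefect (suc n) 0
      ≈⟨ solve 5 (λ q X b₀ b₁ b₂ →
           let Qₙ = q :* X; Y = 𝟙 in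
           ((𝟙 :+ Qₙ :* Qₙ) :* b₁ :- Qₙ :* (b₀ :+ b₂)) :* (𝟙 :- Qₙ :* (q :* (q :* Y)))
             :+ (q :* Y :- q :* Qₙ) :* ((𝟙 :+ Qₙ :* Qₙ :+ Qₙ) :* b₀ :- Qₙ :* b₁)
           := (𝟙 :+ q :* Qₙ :* Qₙ) :* (b₁ :* (𝟙 :- X :* (q :* (q :* Y))) :+ (q :* Y :- Qₙ) :* b₀)
             :- Qₙ :* (b₂ :* (𝟙 :- X :* (q :* (q :* (q :* Y)))) :+ (q :* (q :* Y) :- Qₙ) :* b₁))
           refl q (q ^ n) (theta n 0) (theta n 1) (theta n 2) ⟩
    (1# + q * Qₙ * Qₙ) * thetaDefect n 0 - Qₙ * thetaDefect n 1
      ≈⟨ +-cong (trans (*-congˡ (thetaDefect≈0 n 0)) (zeroʳ _))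
           (-‿cong (trans (*-congˡ (thetaDefect≈0 n 1)) (zeroʳ _))) ⟩
    0# - 0#  ≈⟨ -‿inverseʳ 0# ⟩
    0#       ∎
    where Qₙ = q ^ suc n
  thetaDefect≈0 (suc n) (suc k) = begin
    thetaDefect (suc n) (suc k)
      ≈⟨ solve 7 (λ q X Y b₀ b₁ b₂ b₃ →
           let Qₙ = q :* X; Y₁ = q :* Y; Y₂ = q :* Y₁; Y₃ = q :* Y₂; Y₄ = q :* Y₃ in
           ((𝟙 :+ Qₙ :* Qₙ) :* b₂ :- Qₙ :* (b₁ :+ b₃)) :* (𝟙 :- Qₙ :* Y₃)
             :+ (Y₂ :- q :* Qₙ) :* ((𝟙 :+ Qₙ :* Qₙ) :* b₁ :- Qₙ :* (b₀ :+ b₂))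
           := (𝟙 :+ q :* Qₙ :* Qₙ) :* (b₂ :* (𝟙 :- X :* Y₃) :+ (Y₂ :- Qₙ) :* b₁)
             :- Qₙ :* q :* (b₁ :* (𝟙 :- X :* Y₂) :+ (Y₁ :- Qₙ) :* b₀)
             :- Qₙ :* (b₃ :* (𝟙 :- X :* Y₄) :+ (Y₃ :- Qₙ) :* b₂))
           refl q (q ^ n) (q ^ k) (theta n k) (theta n (1 ℕ.+ k)) (theta n (2 ℕ.+ k)) (theta n (3 ℕ.+ k)) ⟩
    (1# + q * Qₙ * Qₙ) * thetaDefect n (suc k) - Qₙ * q * thetaDefect n k - Qₙ * thetaDefect n (2 ℕ.+ k)
      ≈⟨ +-cong (+-cong (trans (*-congˡ (thetaDefect≈0 n (suc k))) (zeroʳ _))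
           (-‿cong (trans (*-congˡ (thetaDefect≈0 n k)) (zeroʳ _))))
           (-‿cong (trans (*-congˡ (thetaDefect≈0 n (2 ℕ.+ k))) (zeroʳ _))) ⟩
    0# - 0# - 0#  ≈⟨ +-congʳ (-‿inverseʳ 0#) ⟩
    0# - 0#       ≈⟨ -‿inverseʳ 0# ⟩
    0#            ∎
    where Qₙ = q ^ suc n

  -- The value at z = 1 of the derivative of the product above, cut off at k ≤ K.
  thetaSum : ℕ → ℕ → Carrier
  thetaSum n K = ∑ K (λ k → odd k * theta n k)

  -- At z = 1 the two new factors contribute (1 - q^(n+1))²; the remaining term is what the cut-off
  -- at `k` leaves at the boundary.
  thetaSum-suc : ∀ n k → let Qₙ = q ^ suc n in
    thetaSum (suc n) k ≈
    (1# - Qₙ) * (1# - Qₙ) * thetaSum n k + Qₙ * (odd (suc k) * theta n k - odd k * theta n (suc k))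
  thetaSum-suc n zero = solve 3 (λ Qₙ b₀ b₁ →
    𝟙 :* ((𝟙 :+ Qₙ :* Qₙ :+ Qₙ) :* b₀ :- Qₙ :* b₁)
    := (𝟙 :- Qₙ) :* (𝟙 :- Qₙ) :* (𝟙 :* b₀) :+ Qₙ :* ((𝟙 :+ (𝟙 :+ 𝟙)) :* b₀ :- 𝟙 :* b₁))
    refl (q ^ suc n) (theta n 0) (theta n 1)
  thetaSum-suc n (suc k) = begin
    thetaSum (suc n) k + odd (suc k) * theta (suc n) (suc k)
      ≈⟨ +-congʳ (thetaSum-suc n k) ⟩
    (1# - Qₙ) * (1# - Qₙ) * thetaSum n k + Qₙ * (odd (suc k) * theta n k - odd k * theta n (suc k))
      + odd (suc k) * theta (suc n) (suc k)
      ≈⟨ solve 6 (λ Qₙ S o b₀ b₁ b₂ → let o₁ = o :+ (𝟙 :+ 𝟙) in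
           (𝟙 :- Qₙ) :* (𝟙 :- Qₙ) :* S :+ Qₙ :* (o₁ :* b₀ :- o :* b₁)
             :+ o₁ :* ((𝟙 :+ Qₙ :* Qₙ) :* b₁ :- Qₙ :* (b₀ :+ b₂))
           := (𝟙 :- Qₙ) :* (𝟙 :- Qₙ) :* (S :+ o₁ :* b₁) :+ Qₙ :* ((o₁ :+ (𝟙 :+ 𝟙)) :* b₁ :- o₁ :* b₂))
           refl Qₙ (thetaSum n k) (odd k) (theta n k) (theta n (suc k)) (theta n (2 ℕ.+ k)) ⟩
    (1# - Qₙ) * (1# - Qₙ) * thetaSum n (suc k)
      + Qₙ * (odd (2 ℕ.+ k) * theta n (suc k) - odd (suc k) * theta n (2 ℕ.+ k))  ∎
    where Qₙ = q ^ suc n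

  -- The factor 1 - z⁻¹ vanishes at z = 1 with derivative 1, so only the value of the other factors
  -- survives. The bound `n ≤ k` makes the boundary terms vanish.
  thetaSum≈eulerProduct² : ∀ n k → n ≤ k → thetaSum n k ≈ eulerProduct q n * eulerProduct q n
  thetaSum≈eulerProduct² zero k _ = trans (head k) (sym (*-identityˡ 1#))
    where
    head : ∀ k → thetaSum 0 k ≈ 1#
    head zero    = *-identityˡ 1#
    head (suc k) = trans (+-cong (head k) (zeroʳ _)) (+-identityʳ 1#)
  thetaSum≈eulerProduct² (suc n) k n<k = begin
    thetaSum (suc n) k  ≈⟨ thetaSum-suc n k ⟩
    (1# - Qₙ) * (1# - Qₙ) * thetaSum n k + Qₙ * (odd (suc k) * theta n k - odd k * theta n (suc k))
      ≈⟨ +-cong (*-congˡ (thetaSum≈eulerProduct² n k (ℕ.<⇒≤ n<k)))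
           (trans (*-congˡ (trans (+-cong
               (trans (*-congˡ (theta-vanishes n k n<k)) (zeroʳ _))
               (-‿cong (trans (*-congˡ (theta-vanishes n (suc k) (ℕ.m<n⇒m<1+n n<k))) (zeroʳ _))))
             (-‿inverseʳ 0#))) (zeroʳ Qₙ)) ⟩
    (1# - Qₙ) * (1# - Qₙ) * (E * E) + 0#
      ≈⟨ +-identityʳ _ ⟩
    (1# - Qₙ) * (1# - Qₙ) * (E * E)
      ≈⟨ solve 2 (λ Qₙ E → (𝟙 :- Qₙ) :* (𝟙 :- Qₙ) :* (E :* E) := E :* (𝟙 :- Qₙ) :* (E :* (𝟙 :- Qₙ))) refl Qₙ E ⟩
    eulerProduct q (suc n) * eulerProduct q (suc n)  ∎
    where
    Qₙ = q ^ suc n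
    E = eulerProduct q n

  -- The constant term is the Gaussian binomial coefficient of 2n + 1 over n, here cleared of
  -- denominators. The vanishing defect at 0 eliminates `theta n 1` from the recursion.
  theta-constantTerm : ∀ n →
    eulerProduct q n * eulerProduct q (suc n) * theta n 0 ≈ eulerProduct q (suc (n ℕ.+ n))
  theta-constantTerm zero    = trans (*-identityʳ _) (*-identityˡ _)
  theta-constantTerm (suc n) = begin
    E * (1# - Qₙ) * (E₁ * (1# - q * Qₙ)) * theta (suc n) 0
      ≈⟨ solve 6 (λ q X E E₁ b₀ b₁ → let Qₙ = q :* X in
           E :* (𝟙 :- Qₙ) :* (E₁ :* (𝟙 :- q :* Qₙ)) :* ((𝟙 :+ Qₙ :* Qₙ :+ Qₙ) :* b₀ :- Qₙ :* b₁)
           := E :* E₁ :* b₀ :* (𝟙 :- Qₙ :* Qₙ) :* (𝟙 :- q :* Qₙ :* Qₙ)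
             :- E :* E₁ :* (𝟙 :- Qₙ) :* Qₙ :* (b₁ :* (𝟙 :- X :* (q :* (q :* 𝟙))) :+ (q :* 𝟙 :- Qₙ) :* b₀))
           refl q (q ^ n) E E₁ (theta n 0) (theta n 1) ⟩
    E * E₁ * theta n 0 * (1# - Qₙ * Qₙ) * (1# - q * Qₙ * Qₙ) - E * E₁ * (1# - Qₙ) * Qₙ * thetaDefect n 0
      ≈⟨ +-congˡ (-‿cong (trans (*-congˡ (thetaDefect≈0 n 0)) (zeroʳ _))) ⟩
    E * E₁ * theta n 0 * (1# - Qₙ * Qₙ) * (1# - q * Qₙ * Qₙ) - 0#
      ≈⟨ trans (+-congˡ -0#≈0#) (+-identityʳ _) ⟩
    E * E₁ * theta n 0 * (1# - Qₙ * Qₙ) * (1# - q * Qₙ * Qₙ)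
      ≈⟨ *-cong (*-cong (theta-constantTerm n) (+-congˡ (-‿cong (sym q^2+2n))))
           (+-congˡ (-‿cong (trans (*-assoc _ _ _) (*-congˡ (sym q^2+2n))))) ⟩
    eulerProduct q (3 ℕ.+ (n ℕ.+ n))
      ≈⟨ reflexive (≡.cong (λ m → eulerProduct q (2 ℕ.+ m)) (≡.sym (ℕ.+-suc n n))) ⟩
    eulerProduct q (suc (suc n ℕ.+ suc n))  ∎
    where
    Qₙ = q ^ suc n
    E = eulerProduct q n
    E₁ = eulerProduct q (suc n)
    q^2+2n : q ^ (2 ℕ.+ (n ℕ.+ n)) ≈ Qₙ * Qₙ
    q^2+2n = trans (reflexive (≡.cong (λ m → q ^ suc m) (≡.sym (ℕ.+-suc n n)))) (^-homo-* q (suc n) (suc n))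

  -- Shanks' finite form of the pentagonal number theorem:
  --   Σ_{k ≤ n} (-1)^k q^(n k + k (k + 1) / 2) ∏_{k < i ≤ n} (1 - q^i)
  --     = Σ_{-n ≤ k ≤ n} (-1)^k q^(k (3 k + 1) / 2).

  -- The summand for n = k + d.
  shanks : ℕ → ℕ → Carrier
  shanks k zero    = pentagonal k
  shanks k (suc d) = shanks k d * (q ^ k * (1# - q ^ k * q ^ suc d))

  -- Neighbouring summands for the same n = k + d + 1, compared without division: 1 - q^(k+1) is the
  -- factor that the shorter product has lost.
  shanks-suc : ∀ k d →
    shanks (suc k) d * (1# - q ^ suc k) ≈ - (q ^ k * q ^ k * q ^ d * (q * q) * shanks k (suc d))
  shanks-suc k zero    = solve 3 (λ q X u →
    :- (X :* X :* X :* (q :* q) :* u) :* (𝟙 :- q :* X)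
    := :- (X :* X :* 𝟙 :* (q :* q) :* (u :* (X :* (𝟙 :- X :* (q :* 𝟙))))))
    refl q (q ^ k) (pentagonal k)
  shanks-suc k (suc d) = begin
    shanks (suc k) d * (q * X * (1# - q * X * (q * D))) * (1# - q * X)
      ≈⟨ solve 4 (λ q X D t → t :* (q :* X :* (𝟙 :- q :* X :* (q :* D))) :* (𝟙 :- q :* X)
                   := t :* (𝟙 :- q :* X) :* (q :* X :* (𝟙 :- q :* X :* (q :* D))))
           refl q X D (shanks (suc k) d) ⟩
    shanks (suc k) d * (1# - q * X) * (q * X * (1# - q * X * (q * D)))
      ≈⟨ *-congʳ (shanks-suc k d) ⟩
    - (X * X * D * (q * q) * shanks k (suc d)) * (q * X * (1# - q * X * (q * D)))
      ≈⟨ solve 4 (λ q X D t → :- (X :* X :* D :* (q :* q) :* t) :* (q :* X :* (𝟙 :- q :* X :* (q :* D)))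
                   := :- (X :* X :* (q :* D) :* (q :* q) :* (t :* (X :* (𝟙 :- X :* (q :* (q :* D)))))))
           refl q X D (shanks k (suc d)) ⟩
    - (X * X * (q * D) * (q * q) * shanks k (2 ℕ.+ d))  ∎
    where
    X = q ^ k
    D = q ^ d

  -- The partial sum over k ≤ m, for n = m + d.
  shanksSum : ℕ → ℕ → Carrier
  shanksSum zero    d = shanks 0 d
  shanksSum (suc m) d = shanksSum m (suc d) + shanks (suc m) d

  -- Passing from n = m + d to n + 1 changes every summand, but by `shanks-suc` the changes
  -- telescope to one boundary term. For `d = 0` that term is the pentagonal term of index -(m + 1).
  shanksSum-suc : ∀ m d →
    shanksSum m (suc d) ≈ shanksSum m d - q ^ m * q ^ m * q ^ suc d * shanks m d
  shanksSum-suc zero d = solve 2 (λ D t → t :* (𝟙 :* (𝟙 :- 𝟙 :* D)) := t :- 𝟙 :* 𝟙 :* D :* t)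
    refl (q ^ suc d) (shanks 0 d)
  shanksSum-suc (suc m) d = begin
    shanksSum m (2 ℕ.+ d) + t * (q * X * (1# - q * X * (q * D)))
      ≈⟨ +-congʳ (shanksSum-suc m (suc d)) ⟩
    S - X * X * (q * (q * D)) * s + t * (q * X * (1# - q * X * (q * D)))
      ≈⟨ solve 6 (λ q X D S s t →
           S :- X :* X :* (q :* (q :* D)) :* s :+ t :* (q :* X :* (𝟙 :- q :* X :* (q :* D)))
           := S :+ :- (X :* X :* D :* (q :* q) :* s) :+ t :* (q :* X :* (𝟙 :- q :* X :* (q :* D))))
           refl q X D S s t ⟩
    S + - (X * X * D * (q * q) * s) + t * (q * X * (1# - q * X * (q * D)))
      ≈⟨ +-congʳ (+-congˡ (shanks-suc m d)) ⟨
    S + t * (1# - q * X) + t * (q * X * (1# - q * X * (q * D)))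
      ≈⟨ solve 5 (λ q X D S t →
           S :+ t :* (𝟙 :- q :* X) :+ t :* (q :* X :* (𝟙 :- q :* X :* (q :* D)))
           := S :+ t :- q :* X :* (q :* X) :* (q :* D) :* t)
           refl q X D S t ⟩
    S + t - q * X * (q * X) * (q * D) * t  ∎
    where
    X = q ^ m
    D = q ^ d
    S = shanksSum m (suc d)
    s = shanks m (suc d)
    t = shanks (suc m) d

  shanksSum≈pentagonalSum : ∀ n → shanksSum n 0 ≈ pentagonalSum n
  shanksSum≈pentagonalSum zero    = refl
  shanksSum≈pentagonalSum (suc n) = begin
    shanksSum n 1 + pentagonal (suc n)
      ≈⟨ +-congʳ (trans (shanksSum-suc n 0) (+-congʳ (shanksSum≈pentagonalSum n))) ⟩
    pentagonalSum n - X * X * (q * 1#) * u + u₁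
      ≈⟨ solve 5 (λ q X S u u₁ → S :- X :* X :* (q :* 𝟙) :* u :+ u₁
           := S :+ (u₁ :- X :* X :* q :* u)) refl q X (pentagonalSum n) u u₁ ⟩
    pentagonalSum (suc n)  ∎
    where
    X = q ^ n
    u = pentagonal n
    u₁ = pentagonal (suc n)

  -- The exponent n k + k(k+1)/2 is at least n as soon as k is positive. Hence q^N = 0 leaves only
  -- the summand k = 0 for n = N, and that is the Euler product.
  shanks-divisible : ∀ k d → ∃ λ w → shanks (suc k) d ≈ q ^ (suc k ℕ.+ d) * w
  shanks-divisible k zero = - (q ^ k * q ^ k * q * pentagonal k) , (begin
    - (X * X * X * (q * q) * u)
      ≈⟨ solve 3 (λ q X u → :- (X :* X :* X :* (q :* q) :* u) := q :* X :* :- (X :* X :* q :* u)) refl q X u ⟩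
    q * X * - (X * X * q * u)
      ≈⟨ *-congʳ (reflexive (≡.cong (λ m → q ^ suc m) (≡.sym (ℕ.+-identityʳ k)))) ⟩
    q ^ (suc k ℕ.+ 0) * - (X * X * q * u)  ∎)
    where
    X = q ^ k
    u = pentagonal k
  shanks-divisible k (suc d) with shanks-divisible k d
  ... | w , eq = w * (X * (1# - q * X * (q * D))) , (begin
    shanks (suc k) d * (q * X * (1# - q * X * (q * D)))
      ≈⟨ *-congʳ eq ⟩
    q ^ (suc k ℕ.+ d) * w * (q * X * (1# - q * X * (q * D)))
      ≈⟨ solve 5 (λ q X D Z w → Z :* w :* (q :* X :* (𝟙 :- q :* X :* (q :* D)))
           := q :* Z :* (w :* (X :* (𝟙 :- q :* X :* (q :* D))))) refl q X D (q ^ (suc k ℕ.+ d)) w ⟩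
    q ^ suc (suc k ℕ.+ d) * (w * (X * (1# - q * X * (q * D))))
      ≈⟨ *-congʳ (reflexive (≡.cong (q ^_) (≡.sym (ℕ.+-suc (suc k) d)))) ⟩
    q ^ (suc k ℕ.+ suc d) * (w * (X * (1# - q * X * (q * D))))  ∎)
    where
    X = q ^ k
    D = q ^ d

  shanks≈eulerProduct : ∀ d → shanks 0 d ≈ eulerProduct q d
  shanks≈eulerProduct zero    = refl
  shanks≈eulerProduct (suc d) = *-cong (shanks≈eulerProduct d)
    (trans (*-identityˡ _) (+-congˡ (-‿cong (*-identityˡ _))))

  -- Euler's and Jacobi's identities when q^N = 0

  module _ {N : ℕ} (q^N≈0 : q ^ N ≈ 0#) where

    q^-vanishes : ∀ {n} → N ≤ n → q ^ n ≈ 0#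
    q^-vanishes {n} N≤n = begin
      q ^ n                   ≈⟨ reflexive (≡.cong (q ^_) (≡.sym (ℕ.m+[n∸m]≡n N≤n))) ⟩
      q ^ (N ℕ.+ (n ℕ.∸ N))   ≈⟨ ^-homo-* q N (n ℕ.∸ N) ⟩
      q ^ N * q ^ (n ℕ.∸ N)   ≈⟨ *-congʳ q^N≈0 ⟩
      0# * q ^ (n ℕ.∸ N)      ≈⟨ zeroˡ _ ⟩
      0#                      ∎

    eulerProduct-stable : ∀ j → eulerProduct q (j ℕ.+ N) ≈ eulerProduct q N
    eulerProduct-stable zero    = refl
    eulerProduct-stable (suc j) = begin
      eulerProduct q (j ℕ.+ N) * (1# - q ^ suc (j ℕ.+ N))
        ≈⟨ *-cong (eulerProduct-stable j)
             (+-congˡ (trans (-‿cong (q^-vanishes (ℕ.m≤n⇒m≤1+n (ℕ.m≤n+m N j)))) -0#≈0#)) ⟩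
      eulerProduct q N * (1# + 0#)  ≈⟨ *-congˡ (+-identityʳ 1#) ⟩
      eulerProduct q N * 1#         ≈⟨ *-identityʳ _ ⟩
      eulerProduct q N              ∎

    euler : eulerProduct q N ≈ pentagonalSum N
    euler = begin
      eulerProduct q N           ≈⟨ shanks≈eulerProduct N ⟨
      shanks 0 N                 ≈⟨ reflexive (≡.cong (shanks 0) (ℕ.+-identityʳ N)) ⟨
      shanks 0 (N ℕ.+ 0)         ≈⟨ tail N 0 (ℕ.≤-reflexive (≡.sym (ℕ.+-identityʳ N))) ⟨
      shanksSum N 0              ≈⟨ shanksSum≈pentagonalSum N ⟩
      pentagonalSum N            ∎
      where
      tail : ∀ m d → N ≤ m ℕ.+ d → shanksSum m d ≈ shanks 0 (m ℕ.+ d)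
      tail zero    d _   = refl
      tail (suc m) d N≤n with shanks-divisible m d
      ... | w , eq = begin
        shanksSum m (suc d) + shanks (suc m) d
          ≈⟨ +-cong (tail m (suc d) (ℕ.≤-trans N≤n (ℕ.≤-reflexive (≡.sym (ℕ.+-suc m d)))))
               (trans eq (trans (*-congʳ (q^-vanishes N≤n)) (zeroˡ w))) ⟩
        shanks 0 (m ℕ.+ suc d) + 0#  ≈⟨ +-identityʳ _ ⟩
        shanks 0 (m ℕ.+ suc d)       ≈⟨ reflexive (≡.cong (shanks 0) (ℕ.+-suc m d)) ⟩
        shanks 0 (suc m ℕ.+ d)       ∎

    -- With q^N = 0 the vanishing of the defect becomes the two-term recursion of `alternating`.
    theta≈alternating : ∀ k → theta N k ≈ theta N 0 * alternating k
    theta≈alternating zero    = sym (*-identityʳ _)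
    theta≈alternating (suc k) = begin
      theta N (suc k)
        ≈⟨ solve 5 (λ q X Y b b₁ → b₁ := b₁ :* (𝟙 :- X :* (q :* (q :* Y))) :+ (q :* Y :- q :* X) :* b
             :- q :* Y :* b :+ X :* (b₁ :* (q :* (q :* Y)) :+ q :* b)) refl q X Y (theta N k) (theta N (suc k)) ⟩
      thetaDefect N k - q * Y * theta N k + X * (theta N (suc k) * (q * (q * Y)) + q * theta N k)
        ≈⟨ +-cong (+-cong (thetaDefect≈0 N k) (-‿cong (*-congˡ (theta≈alternating k)))) (*-congʳ q^N≈0) ⟩
      0# - q * Y * (theta N 0 * alternating k) + 0# * (theta N (suc k) * (q * (q * Y)) + q * theta N k)
        ≈⟨ trans (+-cong (+-identityˡ _) (zeroˡ _)) (+-identityʳ _) ⟩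
      - (q * Y * (theta N 0 * alternating k))
        ≈⟨ solve 4 (λ q Y A s → :- (q :* Y :* (A :* s)) := A :* :- (q :* Y :* s)) refl q Y (theta N 0) (alternating k) ⟩
      theta N 0 * alternating (suc k)  ∎
      where
      X = q ^ N
      Y = q ^ k

    -- Let A be the constant term `theta N 0`. The theta sum gives E² = A J, and
    -- `theta-constantTerm` becomes E E A = E, because all Euler products of length at least N
    -- agree. Cancelling one E by means of `P` gives E A = 1, whence E³ = E A J = J.
    jacobi : ∀ {P} → P * eulerProduct q N ≈ 1# →
             eulerProduct q N * (eulerProduct q N * eulerProduct q N) ≈ jacobiSum N
    jacobi {P} PE≈1 = begin
      E * (E * E)              ≈⟨ *-congˡ (thetaSum≈eulerProduct² N N ℕ.≤-refl) ⟨
      E * thetaSum N N   ≈⟨ *-congˡ (∑-cong N reorder) ⟩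
      E * ∑ N (λ k → A * (odd k * alternating k))  ≈⟨ *-congˡ (*-distribˡ-∑ A _ N) ⟩
      E * (A * J)              ≈⟨ *-assoc E A J ⟨
      E * A * J                ≈⟨ *-congʳ EA≈1 ⟩
      1# * J                   ≈⟨ *-identityˡ J ⟩
      J                        ∎
      where
      E = eulerProduct q N
      A = theta N 0
      J = jacobiSum N
      reorder : ∀ k → odd k * theta N k ≈ A * (odd k * alternating k)
      reorder k = trans (*-congˡ (theta≈alternating k))
        (solve 3 (λ o A s → o :* (A :* s) := A :* (o :* s)) refl (odd k) A (alternating k))
      EA≈1 : E * A ≈ 1#
      EA≈1 = begin
        E * A                   ≈⟨ *-identityˡ _ ⟨
        1# * (E * A)            ≈⟨ *-congʳ PE≈1 ⟨
        P * E * (E * A)         ≈⟨ solve 3 (λ P E A → P :* E :* (E :* A) := P :* (E :* E :* A)) refl P E A ⟩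
        P * (E * E * A)
          ≈⟨ *-congˡ (*-congʳ (*-congˡ (eulerProduct-stable 1))) ⟨
        P * (E * eulerProduct q (suc N) * A)       ≈⟨ *-congˡ (theta-constantTerm N) ⟩
        P * eulerProduct q (suc (N ℕ.+ N))         ≈⟨ *-congˡ (eulerProduct-stable (suc N)) ⟩
        P * E                   ≈⟨ PE≈1 ⟩
        1#                      ∎

-- Dissection of series by exponents modulo p

module _ {R : CommutativeRing 0ℓ 0ℓ} where

  open CommutativeRing R

  ∑≤-cong : ∀ {f g : ℕ → Carrier} n → (∀ k → k ≤ n → f k ≈ g k) → ∑≤ _+_ n f ≈ ∑≤ _+_ n g
  ∑≤-cong zero    f≈g = f≈g 0 ℕ.≤-refl
  ∑≤-cong (suc n) f≈g =
    +-cong (∑≤-cong n (λ k k≤n → f≈g k (ℕ.m≤n⇒m≤1+n k≤n))) (f≈g (suc n) ℕ.≤-refl)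

  ∑≤-distribʳ : ∀ c (f : ℕ → Carrier) n → ∑≤ _+_ n f * c ≈ ∑≤ _+_ n (λ k → f k * c)
  ∑≤-distribʳ c f zero    = refl
  ∑≤-distribʳ c f (suc n) = trans (distribʳ c _ _) (+-congʳ (∑≤-distribʳ c f n))

  cyclic-cong : ∀ {u u′ v v′ : ℕ → Carrier} n t →
                (∀ k → k ≤ n → u k ≈ u′ k) → (∀ k → k ≤ n → v k ≈ v′ k) →
                cyclic _+_ _*_ n u v t ≈ cyclic _+_ _*_ n u′ v′ t
  cyclic-cong n t u≈u′ v≈v′ = ∑≤-cong n λ k k≤n →
    *-cong (u≈u′ k k≤n) (v≈v′ _ (ℕ.s≤s⁻¹ (m%n<n (t ℕ.+ (suc n ℕ.∸ k)) (suc n))))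

module Congruence (p-1 : ℕ) where

  p : ℕ
  p = suc p-1

  infix 4 _≡ₘ_ _≡ₘ?_

  record _≡ₘ_ (i j : ℕ) : Set where
    constructor mod
    field residues : i % p ≡ j % p

  open _≡ₘ_ public

  _≡ₘ?_ : ∀ i j → Dec (i ≡ₘ j)
  i ≡ₘ? j = Dec.map′ mod residues (i % p ℕ.≟ j % p)

  ≡ₘ-refl : ∀ i → i ≡ₘ i
  ≡ₘ-refl i = mod ≡.refl

  ≡ₘ-sym : ∀ {i j} → i ≡ₘ j → j ≡ₘ i
  ≡ₘ-sym (mod i≡j) = mod (≡.sym i≡j)

  ≡ₘ-trans : ∀ {i j k} → i ≡ₘ j → j ≡ₘ k → i ≡ₘ k
  ≡ₘ-trans (mod i≡j) (mod j≡k) = mod (≡.trans i≡j j≡k)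

  %-≡ₘ : ∀ n → n % p ≡ₘ n
  %-≡ₘ n = mod (m%n%n≡m%n n p)

  +-cong-≡ₘ : ∀ {i j s r} → i ≡ₘ s → j ≡ₘ r → i ℕ.+ j ≡ₘ s ℕ.+ r
  +-cong-≡ₘ {i} {j} {s} {r} (mod i≡s) (mod j≡r) = mod (begin
    (i ℕ.+ j) % p              ≡⟨ %-distribˡ-+ i j p ⟩
    (i % p ℕ.+ j % p) % p      ≡⟨ ≡.cong₂ (λ x y → (x ℕ.+ y) % p) i≡s j≡r ⟩
    (s % p ℕ.+ r % p) % p      ≡⟨ %-distribˡ-+ s r p ⟨
    (s ℕ.+ r) % p              ∎)
    where open ≡.≡-Reasoning

  +-cancelˡ-≡ₘ : ∀ {i j s r} → i ≡ₘ s → i ℕ.+ j ≡ₘ s ℕ.+ r → j ≡ₘ r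
  +-cancelˡ-≡ₘ {i} {j} {s} {r} i≡s i+j≡s+r =
    ≡ₘ-trans (≡ₘ-sym (drop j)) (≡ₘ-trans
      (+-cong-≡ₘ (≡ₘ-refl (s ℕ.* p-1)) (≡ₘ-trans (+-cong-≡ₘ (≡ₘ-sym i≡s) (≡ₘ-refl j)) i+j≡s+r))
      (drop r))
    where
    -- `s * p-1` serves as -s modulo p without leaving the naturals.
    drop : ∀ j → s ℕ.* p-1 ℕ.+ (s ℕ.+ j) ≡ₘ j
    drop j = mod (≡.trans (≡.cong (_% p)
      (solve 3 (λ s p-1 j → s :* p-1 :+ (s :+ j) := j :+ s :* (con 1 :+ p-1)) ≡.refl s p-1 j))
      ([m+kn]%n≡m%n j s p))
      where open +-*-Solver

module Dissection (K : CommutativeRing 0ℓ 0ℓ) (p-1 N : ℕ) where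

  open Congruence p-1 public
  open Truncated K N public
  private
    module K = CommutativeRing K
  open CommutativeRing seriesRing public hiding (zero)
  open QSums seriesRing q public

  component : ℕ → Series → Series
  component r f n = if does (n ≡ₘ? r) then f n else K.0#

  record Supported (r : ℕ) (f : Series) : Set where
    constructor supported
    field elsewhere : ∀ n → n < N → ¬ (n ≡ₘ r) → f n K.≈ K.0#
  open Supported public

  record Missing (r : ℕ) (f : Series) : Set where
    constructor missing
    field vanishing : ∀ n → n < N → n ≡ₘ r → f n K.≈ K.0#
  open Missing public

  component-≡ : ∀ {r n} f → n ≡ₘ r → component r f n ≡ f n
  component-≡ {r} {n} f n≡r =
    ≡.cong (λ b → if b then f n else K.0#) (dec-true (n ≡ₘ? r) n≡r)

  component-≢ : ∀ {r n} f → ¬ (n ≡ₘ r) → component r f n ≡ K.0#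
  component-≢ {r} {n} f n≢r =
    ≡.cong (λ b → if b then f n else K.0#) (dec-false (n ≡ₘ? r) n≢r)

  component-cong : ∀ r {f g} → f ≋ g → component r f ≋ component r g
  component-cong r f≋g n n<N with does (n ≡ₘ? r)
  ... | true  = f≋g n n<N
  ... | false = K.refl

  component-+ : ∀ r f g → component r (f + g) ≋ component r f + component r g
  component-+ r f g n n<N with does (n ≡ₘ? r)
  ... | true  = K.refl
  ... | false = K.sym (K.+-identityˡ K.0#)

  component-≡ₘ : ∀ {r s} f → r ≡ₘ s → component r f ≋ component s f
  component-≡ₘ {r} {s} f r≡s n _ with n ≡ₘ? s
  ... | yes n≡s = K.reflexive (≡.trans (component-≡ f (≡ₘ-trans n≡s (≡ₘ-sym r≡s))) (≡.sym (component-≡ f n≡s)))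
  ... | no  n≢s = K.reflexive (≡.trans (component-≢ f (λ n≡r → n≢s (≡ₘ-trans n≡r r≡s))) (≡.sym (component-≢ f n≢s)))

  component-supported : ∀ r f → Supported r (component r f)
  component-supported r f = supported λ n _ n≢r → K.reflexive (component-≢ f n≢r)

  missing⇒component≋0 : ∀ {r f} → Missing r f → component r f ≋ 0#
  missing⇒component≋0 {r} {f} f-missing n n<N with n ≡ₘ? r
  ... | yes n≡r = K.trans (K.reflexive (component-≡ f n≡r)) (vanishing f-missing n n<N n≡r)
  ... | no  n≢r = K.reflexive (component-≢ f n≢r)

  component≋0⇒missing : ∀ {r f} → component r f ≋ 0# → Missing r f
  component≋0⇒missing {r} {f} f≋0 = missing λ n n<N n≡r →
    K.trans (K.reflexive (≡.sym (component-≡ f n≡r))) (f≋0 n n<N)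

  supported⇒missing : ∀ {s r f} → Supported s f → ¬ (r ≡ₘ s) → Missing r f
  supported⇒missing f-supp r≢s = missing λ n n<N n≡r →
    elsewhere f-supp n n<N (λ n≡s → r≢s (≡ₘ-trans (≡ₘ-sym n≡r) n≡s))

  missing-cong : ∀ {r f g} → f ≋ g → Missing r f → Missing r g
  missing-cong f≋g f-missing = missing λ n n<N n≡r →
    K.trans (K.sym (f≋g n n<N)) (vanishing f-missing n n<N n≡r)

  missing-0 : ∀ {r f} → f ≋ 0# → Missing r f
  missing-0 f≋0 = missing λ n n<N _ → f≋0 n n<N

  missing-+ : ∀ {r f g} → Missing r f → Missing r g → Missing r (f + g)
  missing-+ f-missing g-missing = missing λ n n<N n≡r →
    K.trans (K.+-cong (vanishing f-missing n n<N n≡r) (vanishing g-missing n n<N n≡r)) (K.+-identityˡ K.0#)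

  missing-∑ : ∀ {r f} n → (∀ k → Missing r (f k)) → Missing r (∑ n f)
  missing-∑ zero    f-missing = f-missing 0
  missing-∑ (suc n) f-missing = missing-+ (missing-∑ n f-missing) (f-missing (suc n))

  supported-+ : ∀ {r f g} → Supported r f → Supported r g → Supported r (f + g)
  supported-+ f-supp g-supp = supported λ n n<N n≢r →
    K.trans (K.+-cong (elsewhere f-supp n n<N n≢r) (elsewhere g-supp n n<N n≢r)) (K.+-identityˡ K.0#)

  supported-neg : ∀ {r f} → Supported r f → Supported r (- f)
  supported-neg f-supp = supported λ n n<N n≢r →
    K.trans (K.-‿cong (elsewhere f-supp n n<N n≢r)) (RingProperties.-0#≈0# K.ring)

  supported-* : ∀ {s r f g} → Supported s f → Supported r g → Supported (s ℕ.+ r) (f * g)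
  supported-* {s} {r} {f} {g} f-supp g-supp = supported λ n n<N n≢s+r → ⊛-zero n (vanish n<N n≢s+r)
    where
    vanish : ∀ {n} → n < N → ¬ (n ≡ₘ s ℕ.+ r) → ∀ i j → i ℕ.+ j ≡ n → f i K.* g j K.≈ K.0#
    vanish n<N n≢s+r i j ≡.refl with i ≡ₘ? s
    ... | no  i≢s = K.trans (K.*-congʳ (elsewhere f-supp i (ℕ.≤-<-trans (ℕ.m≤m+n i j) n<N) i≢s)) (K.zeroˡ _)
    ... | yes i≡s = K.trans (K.*-congˡ (elsewhere g-supp j (ℕ.≤-<-trans (ℕ.m≤n+m j i) n<N)
            (λ j≡r → n≢s+r (+-cong-≡ₘ i≡s j≡r)))) (K.zeroʳ _)

  supported-1 : Supported 0 1#
  supported-1 = supported λ { zero    _ 0≢0 → ⊥-elim (0≢0 (≡ₘ-refl 0))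
                            ; (suc n) _ _   → K.refl }

  supported-q : Supported 1 q
  supported-q = supported λ { zero          _ _   → K.refl
                            ; (suc zero)    _ 1≢1 → ⊥-elim (1≢1 (≡ₘ-refl 1))
                            ; (suc (suc n)) _ _   → K.refl }

  supported-q^ : ∀ k → Supported k (q ^ k)
  supported-q^ zero    = supported-1
  supported-q^ (suc k) = supported-* supported-q (supported-q^ k)

  -- If `f` lives in the class `s`, then an exponent of class `s + r` leaves exactly the class `r`
  -- for `g`. With `s = 0` this makes series in q^p act as scalars on each component.
  component-*ˡ : ∀ {s} r f g → Supported s f → component (s ℕ.+ r) (f * g) ≋ f * component r g
  component-*ˡ {s} r f g f-supp n n<N with n ≡ₘ? s ℕ.+ r
  ... | yes n≡s+r = K.trans (K.reflexive (component-≡ (f * g) n≡s+r)) (⊛-cong n agree)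
    where
    agree : ∀ i j → i ℕ.+ j ≡ n → f i K.* g j K.≈ f i K.* component r g j
    agree i j ≡.refl with i ≡ₘ? s
    ... | yes i≡s = K.*-congˡ (K.reflexive (≡.sym (component-≡ g (+-cancelˡ-≡ₘ i≡s n≡s+r))))
    ... | no  i≢s = K.trans (K.trans (K.*-congʳ fi≈0) (K.zeroˡ _)) (K.sym (K.trans (K.*-congʳ fi≈0) (K.zeroˡ _)))
      where fi≈0 = elsewhere f-supp i (ℕ.≤-<-trans (ℕ.m≤m+n i j) n<N) i≢s
  ... | no n≢s+r = K.trans (K.reflexive (component-≢ (f * g) n≢s+r)) (K.sym
    (elsewhere (supported-* f-supp (component-supported r g)) n n<N n≢s+r))

  ∑-components : ∀ f → ∑ p-1 (λ r → component r f) ≋ f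
  ∑-components f n _ = present p-1 (ℕ.s≤s⁻¹ (m%n<n n p)) ℕ.≤-refl
    where
    n≢ₘ : ∀ {m} → m ≤ p-1 → n % p ≢ m → ¬ (n ≡ₘ m)
    n≢ₘ m≤p-1 n≢m (mod n≡m) = n≢m (≡.trans n≡m (m<n⇒m%n≡m (s≤s m≤p-1)))
    n≡ₘ : ∀ {m} → m ≤ p-1 → n % p ≡ m → n ≡ₘ m
    n≡ₘ m≤p-1 n≡m = mod (≡.trans n≡m (≡.sym (m<n⇒m%n≡m (s≤s m≤p-1))))
    absent : ∀ m → m < n % p → m ≤ p-1 → ∑ m (λ r → component r f) n K.≈ K.0#
    absent zero    m<n m≤p-1 = K.reflexive (component-≢ f (n≢ₘ m≤p-1 (≡.≢-sym (ℕ.<⇒≢ m<n))))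
    absent (suc m) m<n m≤p-1 = K.trans (K.+-cong
      (absent m (ℕ.<-trans (ℕ.n<1+n m) m<n) (ℕ.<⇒≤ m≤p-1))
      (K.reflexive (component-≢ f (n≢ₘ m≤p-1 (≡.≢-sym (ℕ.<⇒≢ m<n)))))) (K.+-identityˡ K.0#)
    present : ∀ m → n % p ≤ m → m ≤ p-1 → ∑ m (λ r → component r f) n K.≈ f n
    present zero    n≤m m≤p-1 = K.reflexive (component-≡ f (n≡ₘ m≤p-1 (ℕ.n≤0⇒n≡0 n≤m)))
    present (suc m) n≤m m≤p-1 with n % p ℕ.≟ suc m
    ... | yes n≡m = K.trans
      (K.+-cong (absent m (ℕ.≤-reflexive (≡.sym n≡m)) (ℕ.<⇒≤ m≤p-1))
        (K.reflexive (component-≡ f (n≡ₘ m≤p-1 n≡m))))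
      (K.+-identityˡ (f n))
    ... | no  n≢m = K.trans
      (K.+-cong (present m (ℕ.s≤s⁻¹ (ℕ.≤∧≢⇒< n≤m n≢m)) (ℕ.<⇒≤ m≤p-1))
        (K.reflexive (component-≢ f (n≢ₘ m≤p-1 n≢m))))
      (K.+-identityʳ (f n))

  component-∑ : ∀ r f n → component r (∑ n f) ≋ ∑ n (λ k → component r (f k))
  component-∑ r f zero    = refl
  component-∑ r f (suc n) = trans (component-+ r (∑ n f) (f (suc n))) (+-congʳ (component-∑ r f n))

  infixl 7 _⋆_
  _⋆_ : (ℕ → Series) → (ℕ → Series) → ℕ → Series
  _⋆_ = cyclic _+_ _*_ p-1

  component-* : ∀ t f g → component t (f * g) ≋ ((λ s → component s f) ⋆ (λ s → component s g)) t
  component-* t f g = begin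
    component t (f * g)
      ≈⟨ component-cong t (*-congʳ (∑-components f)) ⟨
    component t (∑ p-1 (λ s → component s f) * g)
      ≈⟨ component-cong t (∑≤-distribʳ {seriesRing} g (λ s → component s f) p-1) ⟩
    component t (∑ p-1 (λ s → component s f * g))
      ≈⟨ component-∑ t (λ s → component s f * g) p-1 ⟩
    ∑ p-1 (λ s → component t (component s f * g))
      ≈⟨ ∑≤-cong {seriesRing} p-1 term ⟩
    ((λ s → component s f) ⋆ (λ s → component s g)) t  ∎
    where
    open SetoidReasoning setoid
    index : ∀ s → s ≤ p-1 → t ≡ₘ s ℕ.+ (t ℕ.+ (p ℕ.∸ s))
    index s s≤p-1 = ≡ₘ-sym (mod (≡.trans (≡.cong (_% p) (≡.trans
      (solve 3 (λ s t u → s :+ (t :+ u) := t :+ (s :+ u)) ≡.refl s t (p ℕ.∸ s))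
      (≡.cong (t ℕ.+_) (ℕ.m+[n∸m]≡n (ℕ.m≤n⇒m≤1+n s≤p-1))))) ([m+n]%n≡m%n t p)))
      where open +-*-Solver
    term : ∀ s → s ≤ p-1 →
           component t (component s f * g) ≋ component s f * component ((t ℕ.+ (p ℕ.∸ s)) % p) g
    term s s≤p-1 = begin
      component t (component s f * g)
        ≈⟨ component-≡ₘ (component s f * g) (index s s≤p-1) ⟩
      component (s ℕ.+ (t ℕ.+ (p ℕ.∸ s))) (component s f * g)
        ≈⟨ component-*ˡ (t ℕ.+ (p ℕ.∸ s)) (component s f) g (component-supported s f) ⟩
      component s f * component (t ℕ.+ (p ℕ.∸ s)) g
        ≈⟨ *-congˡ (component-≡ₘ g (≡ₘ-sym (%-≡ₘ (t ℕ.+ (p ℕ.∸ s))))) ⟩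
      component s f * component ((t ℕ.+ (p ℕ.∸ s)) % p) g  ∎

  -- U is a unit supported on multiples of p, so it can be divided out class by class.
  missing-unit* : ∀ {t} U V f → Supported 0 U → V * U ≋ 1# → Missing t (U * f) → Missing t f
  missing-unit* {t} U V f U-supp VU≈1 Uf-missing = component≋0⇒missing (begin
    component t f            ≈⟨ *-identityˡ _ ⟨
    1# * component t f       ≈⟨ *-congʳ VU≈1 ⟨
    V * U * component t f    ≈⟨ *-assoc V U _ ⟩
    V * (U * component t f)  ≈⟨ *-congˡ (component-*ˡ t U f U-supp) ⟨
    V * component t (U * f)  ≈⟨ *-congˡ (missing⇒component≋0 Uf-missing) ⟩
    V * 0#                   ≈⟨ zeroʳ V ⟩
    0#                       ∎)
    where open SetoidReasoning setoid

  missing-*ˡ : ∀ {t} U f → Supported 0 U → Missing t f → Missing t (U * f)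
  missing-*ˡ {t} U f U-supp f-missing = component≋0⇒missing
    (trans (component-*ˡ t U f U-supp)
      (trans (*-congˡ (missing⇒component≋0 f-missing)) (zeroʳ U)))

-- Partitions with bounded parts

unique∧set⇒↭ : ∀ {A : Set} {xs ys : List A} → Unique xs → Unique ys →
               (∀ {x} → x ∈ xs → x ∈ ys) → (∀ {x} → x ∈ ys → x ∈ xs) → xs ↭ ys
unique∧set⇒↭ xs! ys! xs⊆ys ys⊆xs = ∼bag⇒↭ (unique∧set⇒bag xs! ys! (mk⇔ xs⊆ys ys⊆xs))

parts≤sum : ∀ ps → All (_≤ sum ps) ps
parts≤sum []       = []
parts≤sum (p ∷ ps) = ℕ.m≤m+n p (sum ps) ∷ All.map (λ r≤s → ℕ.≤-trans r≤s (ℕ.m≤n+m (sum ps) p)) (parts≤sum ps)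

parts≤ : ∀ {m ps} → IsPartition m ps → All (_≤ m) ps
parts≤ {m} {ps} ps⊢m = ≡.subst (λ s → All (_≤ s) ps) (IsPartition.sums ps⊢m) (parts≤sum ps)

-- Raising the bound `b` by one corresponds to one more factor 1 - q^i of the Euler product.
bounded : ℕ → ℕ → List (List ℕ)
bounded b m = filter (all? (_≤? b)) (partitions m)

bounded-unique : ∀ b m → Unique (bounded b m)
bounded-unique b m = Unique.filter⁺ (all? (_≤? b)) (partitions-unique m)

∈-bounded⁺ : ∀ {b m ps} → IsPartition m ps → All (_≤ b) ps → ps ∈ bounded b m
∈-bounded⁺ {b} {m} ps⊢m ps≤b =
  ∈-filter⁺ (all? (_≤? b)) (Equivalence.from (∈-partitions m) ps⊢m) ps≤b

∈-bounded⁻ : ∀ {b m ps} → ps ∈ bounded b m → IsPartition m ps × All (_≤ b) ps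
∈-bounded⁻ {b} {m} ps∈ with ∈-filter⁻ (all? (_≤? b)) {xs = partitions m} ps∈
... | ps∈′ , ps≤b = Equivalence.to (∈-partitions m) ps∈′ , ps≤b

bounded-all : ∀ {b m} → m ≤ b → bounded b m ≡ partitions m
bounded-all {b} {m} m≤b = List.filter-all (all? (_≤? b)) (All.tabulate λ ps∈ →
  All.map (λ r≤m → ℕ.≤-trans r≤m m≤b) (parts≤ (Equivalence.to (∈-partitions m) ps∈)))

bounded-zero : ∀ m → bounded 0 (suc m) ≡ []
bounded-zero m = ↭.↭-empty-inv (unique∧set⇒↭ (bounded-unique 0 (suc m)) [] absurd λ ())
  where
  absurd : ∀ {ps} → ps ∈ bounded 0 (suc m) → ps ∈ []
  absurd ps∈ with ∈-bounded⁻ {0} {suc m} ps∈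
  absurd {[]}     ps∈ | isPartition _ _ () , _
  absurd {r ∷ ps} ps∈ | isPartition _ (0<r ∷ _) _ , r≤0 ∷ _ = ⊥-elim (ℕ.<⇒≱ 0<r r≤0)

bounded-suc-below : ∀ {b m} → m ≤ b → bounded (suc b) m ≡ bounded b m
bounded-suc-below m≤b = ≡.trans (bounded-all (ℕ.m≤n⇒m≤1+n m≤b)) (≡.sym (bounded-all m≤b))

-- In a non-increasing list a part equal to the bound `suc b` can be taken to be the first entry:
-- either it is there and can be removed, or all parts are at most `b`. Lists without repetitions
-- and with the same members are permutations of each other.
bounded-suc-above : ∀ b m →
  bounded (suc b) (suc b ℕ.+ m) ↭ bounded b (suc b ℕ.+ m) ++ map (suc b ∷_) (bounded (suc b) m)
bounded-suc-above b m = unique∧set⇒↭ (bounded-unique (suc b) (suc b ℕ.+ m))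
  (Unique.++⁺ (bounded-unique b (suc b ℕ.+ m))
    (Unique.map⁺ List.∷-injectiveʳ (bounded-unique (suc b) m)) disjoint)
  split merge
  where
  disjoint : ∀ {ps} → ps ∈ bounded b (suc b ℕ.+ m) × ps ∈ map (suc b ∷_) (bounded (suc b) m) → _
  disjoint (ps∈ , ps∈′) with ∈-map⁻ (suc b ∷_) ps∈′
  ... | _ , _ , ≡.refl with ∈-bounded⁻ {b} {suc b ℕ.+ m} ps∈
  ...   | _ , b<b ∷ _ = ℕ.1+n≰n b<b

  split : ∀ {ps} → ps ∈ bounded (suc b) (suc b ℕ.+ m) →
          ps ∈ bounded b (suc b ℕ.+ m) ++ map (suc b ∷_) (bounded (suc b) m)
  split {ps} ps∈ with ∈-bounded⁻ {suc b} {suc b ℕ.+ m} ps∈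
  split {[]}     ps∈ | isPartition _ _ () , _
  split {r ∷ ps} ps∈ | isPartition dec (0<r ∷ pos) eq , r≤1+b ∷ ps≤1+b with r ≟ suc b
  ... | yes ≡.refl = ∈-++⁺ʳ (bounded b (suc b ℕ.+ m)) (∈-map⁺ (suc b ∷_)
          (∈-bounded⁺ (isPartition (Linked.tail dec) pos (ℕ.+-cancelˡ-≡ (suc b) _ _ eq)) ps≤1+b))
  ... | no  r≢1+b  = ∈-++⁺ˡ (∈-bounded⁺ (isPartition dec (0<r ∷ pos) eq)
          (Linked⇒All (λ x≥y y≥z → ℕ.≤-trans y≥z x≥y) (ℕ.s≤s⁻¹ (ℕ.≤∧≢⇒< r≤1+b r≢1+b)) dec))

  prepend : ∀ {ps} → All (_≤ suc b) ps → Linked _≥_ ps → Linked _≥_ (suc b ∷ ps)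
  prepend []          []  = [-]
  prepend (r≤1+b ∷ _) dec = r≤1+b ∷ dec

  merge : ∀ {ps} → ps ∈ bounded b (suc b ℕ.+ m) ++ map (suc b ∷_) (bounded (suc b) m) →
          ps ∈ bounded (suc b) (suc b ℕ.+ m)
  merge ps∈ with ∈-++⁻ (bounded b (suc b ℕ.+ m)) ps∈
  ... | inj₁ ps∈ˡ with ∈-bounded⁻ {b} {suc b ℕ.+ m} ps∈ˡ
  ...   | ps⊢ , ps≤b = ∈-bounded⁺ ps⊢ (All.map ℕ.m≤n⇒m≤1+n ps≤b)
  merge ps∈ | inj₂ ps∈ʳ with ∈-map⁻ (suc b ∷_) ps∈ʳ
  ... | qs , qs∈ , ≡.refl with ∈-bounded⁻ {suc b} {m} qs∈
  ...   | isPartition dec pos eq , qs≤1+b = ∈-bounded⁺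
            (isPartition (prepend qs≤1+b dec) (s≤s z≤n ∷ pos) (≡.cong (suc b ℕ.+_) eq))
            (ℕ.≤-refl ∷ qs≤1+b)

-- The weight is arbitrary so that one recurrence serves both the number of partitions and the
-- number of occurrences of a part.
total : (List ℕ → ℕ) → ℕ → ℕ → ℕ
total w b m = sum (map w (bounded b m))

total-suc-below : ∀ w {b m} → m ≤ b → total w (suc b) m ≡ total w b m
total-suc-below w m≤b = ≡.cong (λ pss → sum (map w pss)) (bounded-suc-below m≤b)

total-suc-above : ∀ w b m →
  total w (suc b) (suc b ℕ.+ m) ≡ total w b (suc b ℕ.+ m) ℕ.+ total (λ ps → w (suc b ∷ ps)) (suc b) m
total-suc-above w b m = begin
  sum (map w (bounded (suc b) (suc b ℕ.+ m)))
    ≡⟨ sum-↭ (↭.map⁺ w (bounded-suc-above b m)) ⟩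
  sum (map w (bounded b (suc b ℕ.+ m) ++ map (suc b ∷_) (bounded (suc b) m)))
    ≡⟨ ≡.cong sum (List.map-++ w (bounded b (suc b ℕ.+ m)) _) ⟩
  sum (map w (bounded b (suc b ℕ.+ m)) ++ map w (map (suc b ∷_) (bounded (suc b) m)))
    ≡⟨ sum-++ (map w (bounded b (suc b ℕ.+ m))) _ ⟩
  total w b (suc b ℕ.+ m) ℕ.+ sum (map w (map (suc b ∷_) (bounded (suc b) m)))
    ≡⟨ ≡.cong (λ xs → total w b (suc b ℕ.+ m) ℕ.+ sum xs) (List.map-∘ (bounded (suc b) m)) ⟨
  total w b (suc b ℕ.+ m) ℕ.+ total (λ ps → w (suc b ∷ ps)) (suc b) m  ∎
  where open ≡.≡-Reasoning

total-+ : ∀ v w b m → total (λ ps → v ps ℕ.+ w ps) b m ≡ total v b m ℕ.+ total w b m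
total-+ v w b m = go (bounded b m)
  where
  open +-*-Solver
  go : ∀ pss → sum (map (λ ps → v ps ℕ.+ w ps) pss) ≡ sum (map v pss) ℕ.+ sum (map w pss)
  go []         = ≡.refl
  go (ps ∷ pss) = ≡.trans (≡.cong (v ps ℕ.+ w ps ℕ.+_) (go pss))
    (solve 4 (λ a b c d → a :+ b :+ (c :+ d) := a :+ c :+ (b :+ d)) ≡.refl
      (v ps) (w ps) (sum (map v pss)) (sum (map w pss)))

occurrences-∷-≡ : ∀ k ps → occurrences k (k ∷ ps) ≡ suc (occurrences k ps)
occurrences-∷-≡ k ps = ≡.cong length (List.filter-accept (k ℕ.≟_) ≡.refl)

occurrences-∷-≢ : ∀ {k r} ps → k ≢ r → occurrences k (r ∷ ps) ≡ occurrences k ps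
occurrences-∷-≢ {k} ps k≢r = ≡.cong length (List.filter-reject (k ℕ.≟_) k≢r)

total-cong : ∀ {v w} b m → (∀ ps → v ps ≡ w ps) → total v b m ≡ total w b m
total-cong b m v≗w = ≡.cong sum (List.map-cong v≗w (bounded b m))

-- Polynomial identities in characteristic 5, 7 and 11

sparse : ∀ {A : Set} → A → List (ℕ × A) → ℕ → A
sparse z []              s = z
sparse z ((r , a) ∷ ras) s = if s ≡ᵇ r then a else sparse z ras s

module Characteristic
  (R : CommutativeRing 0ℓ 0ℓ)
  (ι : ℤ⟶ R)
  (p : ℕ)
  (p≈0 : Kills ι p)
  where

  open CommutativeRing R
  open _-Raw-AlmostCommutative⟶_ ι
  open RingSolver ℤ.+-*-rawRing (fromCommutativeRing R) ι (IntegerCoefficients._coeff≟_ R ι p p≈0)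
    public using (solve; _:=_; Polynomial; con; _:+_; _:*_; _:-_; _:^_)

  -- Normal forms drop coefficients divisible by `p` but do not reduce the others to fixed
  -- representatives. An identity that holds only modulo `p` is therefore posed as a difference
  -- equal to zero.
  difference≈0 : ∀ {x y} → x - y ≈ ⟦ + 0 ⟧ → x ≈ y
  difference≈0 {x} {y} eq = RingProperties.x∙y⁻¹≈ε⇒x≈y ring x y (trans eq 0-homo)

module Certificate₅
  (R : CommutativeRing 0ℓ 0ℓ)
  (ι : ℤ⟶ R)
  (p≈0 : Kills ι 5)
  where

  open CommutativeRing R
  open _-Raw-AlmostCommutative⟶_ ι
  open Characteristic R ι 5 p≈0
  open Exp semiring using (_^_)

  frobenius : ∀ x → (1# - x) ^ 5 ≈ 1# - x ^ 5
  frobenius x = difference≈0 (solve 1 (λ x → let 𝟙 = x :^ 0 in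
    (𝟙 :- x) :^ 5 :- (𝟙 :- x :^ 5) := con (+ 0)) refl x)

  private
    infixl 7 _⋆_
    _⋆_ : (ℕ → Carrier) → (ℕ → Carrier) → ℕ → Carrier
    _⋆_ = cyclic _+_ _*_ 4

  -- Three classes chosen from 0 and 1 add up to at most 3, so none of the products falls into class
  -- 4. The default value is `⟦ + 0 ⟧` because this is what the solver's `con (+ 0)` denotes.
  cube : ∀ {c₁ c₂ : ℕ → Carrier} →
         (∀ s → s ≤ 4 → c₁ s ≈ sparse ⟦ + 0 ⟧ (map (λ r → r , c₁ r) (0 ∷ 1 ∷ [])) s) →
         (∀ s → c₂ s ≈ (c₁ ⋆ c₁) s) →
         (c₁ ⋆ c₂) 4 ≈ 0#
  cube {c₁} c₁≈w c₂≈c₁² = trans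
    (cyclic-cong {R} 4 4 c₁≈w (λ s _ → trans (c₂≈c₁² s) (cyclic-cong {R} 4 s c₁≈w c₁≈w)))
    (trans (solve 2 (λ a b →
      let w = sparse (con (+ 0)) ((0 , a) ∷ (1 , b) ∷ [])
          _⊗_ = cyclic _:+_ _:*_ 4 in
      (w ⊗ (w ⊗ w)) 4 := con (+ 0)) refl (c₁ 0) (c₁ 1)) 0-homo)

module Certificate₇
  (R : CommutativeRing 0ℓ 0ℓ)
  (ι : ℤ⟶ R)
  (p≈0 : Kills ι 7)
  where

  open CommutativeRing R
  open _-Raw-AlmostCommutative⟶_ ι
  open Characteristic R ι 7 p≈0
  open Exp semiring using (_^_)

  frobenius : ∀ x → (1# - x) ^ 7 ≈ 1# - x ^ 7
  frobenius x = difference≈0 (solve 1 (λ x → let 𝟙 = x :^ 0 in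
    (𝟙 :- x) :^ 7 :- (𝟙 :- x :^ 7) := con (+ 0)) refl x)

  -- No two of the classes 0, 1, 3 add up to 5 modulo 7.
  square : ∀ {c₁ : ℕ → Carrier} →
           (∀ s → s ≤ 6 → c₁ s ≈ sparse ⟦ + 0 ⟧ (map (λ r → r , c₁ r) (0 ∷ 1 ∷ 3 ∷ [])) s) →
           cyclic _+_ _*_ 6 c₁ c₁ 5 ≈ 0#
  square {c₁} c₁≈w = trans (cyclic-cong {R} 6 5 c₁≈w c₁≈w)
    (trans (solve 3 (λ a b c →
      let w = sparse (con (+ 0)) ((0 , a) ∷ (1 , b) ∷ (3 , c) ∷ []) in
      cyclic _:+_ _:*_ 6 w w 5 := con (+ 0)) refl (c₁ 0) (c₁ 1) (c₁ 3)) 0-homo)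

module Certificate₁₁
  (R : CommutativeRing 0ℓ 0ℓ)
  (ι : ℤ⟶ R)
  (p≈0 : Kills ι 11)
  where

  open CommutativeRing R
  open _-Raw-AlmostCommutative⟶_ ι
  open Characteristic R ι 11 p≈0
  open Exp semiring using (_^_)

  frobenius : ∀ x → (1# - x) ^ 11 ≈ 1# - x ^ 11
  frobenius x = difference≈0 (solve 1 (λ x → let 𝟙 = x :^ 0 in
    (𝟙 :- x) :^ 11 :- (𝟙 :- x :^ 11) := con (+ 0)) refl x)

  private
    infixl 7 _⋆_
    _⋆_ : (ℕ → Carrier) → (ℕ → Carrier) → ℕ → Carrier
    _⋆_ = cyclic _+_ _*_ 10

  -- The cubic cofactors of the five quartic relations come from linear algebra modulo 11.
  seventhPower : ∀ {c₁ c₂ c₃ c₄ : ℕ → Carrier} →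
    (∀ s → s ≤ 10 → c₁ s ≈ sparse ⟦ + 0 ⟧ (map (λ r → r , c₁ r) (0 ∷ 1 ∷ 3 ∷ 6 ∷ 10 ∷ [])) s) →
    (∀ s → c₂ s ≈ (c₁ ⋆ c₁) s) → (∀ s → c₃ s ≈ (c₁ ⋆ c₂) s) → (∀ s → c₄ s ≈ (c₂ ⋆ c₂) s) →
    c₄ 3 ≈ 0# → c₄ 6 ≈ 0# → c₄ 8 ≈ 0# → c₄ 9 ≈ 0# → c₄ 10 ≈ 0# →
    (c₃ ⋆ c₄) 6 ≈ 0#
  seventhPower {c₁} {c₂} {c₃} {c₄} c₁≈w c₂≈c₁² c₃≈c₁c₂ c₄≈c₂² c₄3≈0 c₄6≈0 c₄8≈0 c₄9≈0 c₄10≈0 = trans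
    (cyclic-cong {R} 10 6 (λ s _ → c₃≈w³ s) (λ s _ → c₄≈w⁴ s))
    (trans (difference≈0 (solve 5 (λ a b c d e →
      let w = sparse (con (+ 0)) ((0 , a) ∷ (1 , b) ∷ (3 , c) ∷ (6 , d) ∷ (10 , e) ∷ [])
          _⊗_ = cyclic _:+_ _:*_ 10
          w⁴ = (w ⊗ w) ⊗ (w ⊗ w)
          four = con (+ 4) in
      ((w ⊗ (w ⊗ w)) ⊗ w⁴) 6
      -- Attach 8s + 1 to the class s of `w`: the variables a, b, e, c, d then carry the squares 1,
      -- 9, 4, 3, 5. The substitution a → b → e → c → d → a multiplies these by 9 modulo 11. It
      -- preserves the class 6 of the seventh power, where the attached values add up to 0, and it
      -- carries the relations 3, 9, 8, 10, 6 cyclically into each other. One cofactor thus yields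
      -- the other four.
      :- (w⁴ 3 :* (four :* a :* a :* c :- b :* b :* b :- b :* c :* e)
          :+ w⁴ 6 :* (four :* d :* d :* e :- a :* a :* a :- a :* b :* e)
          :+ w⁴ 8 :* (four :* a :* e :* e :- c :* c :* c :- a :* c :* d)
          :+ w⁴ 9 :* (four :* b :* b :* d :- e :* e :* e :- c :* d :* e)
          :+ w⁴ 10 :* (four :* b :* c :* c :- d :* d :* d :- a :* b :* d))
      := con (+ 0)) refl (c₁ 0) (c₁ 1) (c₁ 3) (c₁ 6) (c₁ 10)))
    (annihilate (annihilate (annihilate (annihilate
      (annihilate′ (w⁴≈0 3 c₄3≈0)) (w⁴≈0 6 c₄6≈0)) (w⁴≈0 8 c₄8≈0)) (w⁴≈0 9 c₄9≈0)) (w⁴≈0 10 c₄10≈0)))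
    where
    w : ℕ → Carrier
    w = sparse ⟦ + 0 ⟧ (map (λ r → r , c₁ r) (0 ∷ 1 ∷ 3 ∷ 6 ∷ 10 ∷ []))
    c₂≈w² : ∀ s → c₂ s ≈ (w ⋆ w) s
    c₂≈w² s = trans (c₂≈c₁² s) (cyclic-cong {R} 10 s c₁≈w c₁≈w)
    c₃≈w³ : ∀ s → c₃ s ≈ (w ⋆ (w ⋆ w)) s
    c₃≈w³ s = trans (c₃≈c₁c₂ s) (cyclic-cong {R} 10 s c₁≈w (λ r _ → c₂≈w² r))
    c₄≈w⁴ : ∀ s → c₄ s ≈ ((w ⋆ w) ⋆ (w ⋆ w)) s
    c₄≈w⁴ s = trans (c₄≈c₂² s) (cyclic-cong {R} 10 s (λ r _ → c₂≈w² r) (λ r _ → c₂≈w² r))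
    w⁴≈0 : ∀ s → c₄ s ≈ 0# → ((w ⋆ w) ⋆ (w ⋆ w)) s ≈ 0#
    w⁴≈0 s c₄≈0 = trans (sym (c₄≈w⁴ s)) c₄≈0
    annihilate′ : ∀ {x y} → x ≈ 0# → x * y ≈ 0#
    annihilate′ {y = y} x≈0 = trans (*-congʳ x≈0) (zeroˡ y)
    annihilate : ∀ {x y z} → z ≈ 0# → x ≈ 0# → z + x * y ≈ 0#
    annihilate z≈0 x≈0 = trans (+-cong z≈0 (annihilate′ x≈0)) (+-identityˡ 0#)

-- Algebra of E, its inverse P and J = E³

module Elementary
  (R : CommutativeRing 0ℓ 0ℓ)
  (ι : ℤ⟶ R)
  where

  open CommutativeRing R hiding (zero)
  open _-Raw-AlmostCommutative⟶_ ι
  open Characteristic R ι 0 0-homo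
  open SetoidReasoning setoid
  open CommutativeExp commutativeSemiring using (_^_; ^-distrib-*; ^-assocʳ; ^-congˡ; ^-congʳ)

  geometric : ∀ {f g} x → f ≈ g + x * f → f * (1# - x) ≈ g
  geometric {f} {g} x f≈g+xf = begin
    f * (1# - x)
      ≈⟨ solve 3 (λ x f g → f :* (x :^ 0 :- x) := (f :- (g :+ x :* f)) :+ g) refl x f g ⟩
    (f - (g + x * f)) + g  ≈⟨ +-congʳ (+-congˡ (-‿cong f≈g+xf)) ⟨
    (f - f) + g            ≈⟨ trans (+-congʳ (-‿inverseʳ f)) (+-identityˡ g) ⟩
    g                      ∎

  -- Turns the closed form f = x / (E (1 - x)) back into a recurrence; multiplication by `P`
  -- replaces the division by `E`.
  ungeometric : ∀ {f P E} x → P * E ≈ 1# → f * E * (1# - x) ≈ x → f ≈ x * (f + P)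
  ungeometric {f} {P} {E} x PE≈1 fE[1-x]≈x = begin
    f                               ≈⟨ *-identityʳ f ⟨
    f * 1#                          ≈⟨ *-congˡ PE≈1 ⟨
    f * (P * E)
      ≈⟨ solve 4 (λ f P E x → f :* (P :* E) := (f :* E :* (x :^ 0 :- x)) :* P :+ x :* (f :* (P :* E))) refl f P E x ⟩
    (f * E * (1# - x)) * P + x * (f * (P * E))
      ≈⟨ +-cong (*-congʳ fE[1-x]≈x) (*-congˡ (trans (*-congˡ PE≈1) (*-identityʳ f))) ⟩
    x * P + x * f                   ≈⟨ +-comm _ _ ⟩
    x * f + x * P                   ≈⟨ distribˡ x f P ⟨
    x * (f + P)                     ∎

  swap : ∀ f e y → f * (e * y) ≈ f * y * e
  swap = solve 3 (λ f e y → f :* (e :* y) := f :* y :* e) refl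

  *-inverse² : ∀ {x y} → x * y ≈ 1# → (x * x) * (y * y) ≈ 1#
  *-inverse² {x} {y} xy≈1 = trans
    (solve 2 (λ x y → (x :* x) :* (y :* y) := (x :* y) :* (x :* y)) refl x y)
    (trans (*-cong xy≈1 xy≈1) (*-identityˡ 1#))

  1^n≈1 : ∀ n → 1# ^ n ≈ 1#
  1^n≈1 zero    = refl
  1^n≈1 (suc n) = trans (*-identityˡ _) (1^n≈1 n)

  ^-inverse : ∀ {x y} n → x * y ≈ 1# → x ^ n * y ^ n ≈ 1#
  ^-inverse {x} {y} n xy≈1 = trans (sym (^-distrib-* x y n)) (trans (^-congˡ n xy≈1) (1^n≈1 n))

  module _ {P E J : Carrier} (PE≈1 : P * E ≈ 1#) (E³≈J : E * (E * E) ≈ J) where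

    E¹⁰P≈J³ : E ^ 5 * E ^ 5 * P ≈ J * (J * J)
    E¹⁰P≈J³ = begin
      E ^ 5 * E ^ 5 * P
        ≈⟨ solve 2 (λ P E → E :^ 5 :* E :^ 5 :* P
             := (E :* (E :* E)) :* ((E :* (E :* E)) :* (E :* (E :* E))) :* (P :* E)) refl P E ⟩
      (E * (E * E)) * ((E * (E * E)) * (E * (E * E))) * (P * E)
        ≈⟨ *-cong (*-cong E³≈J (*-cong E³≈J E³≈J)) PE≈1 ⟩
      J * (J * J) * 1#  ≈⟨ *-identityʳ _ ⟩
      J * (J * J)       ∎

    E⁷P≈J² : E ^ 7 * P ≈ J * J
    E⁷P≈J² = begin
      E ^ 7 * P
        ≈⟨ solve 2 (λ P E → E :^ 7 :* P := (E :* (E :* E)) :* (E :* (E :* E)) :* (P :* E)) refl P E ⟩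
      (E * (E * E)) * (E * (E * E)) * (P * E)  ≈⟨ *-cong (*-cong E³≈J E³≈J) PE≈1 ⟩
      J * J * 1#  ≈⟨ *-identityʳ _ ⟩
      J * J       ∎

    E²²P≈J⁷ : E ^ 11 * E ^ 11 * P ≈ (J * (J * J)) * ((J * J) * (J * J))
    E²²P≈J⁷ = begin
      E ^ 11 * E ^ 11 * P
        ≈⟨ solve 2 (λ P E → let J = E :* (E :* E) in
             E :^ 11 :* E :^ 11 :* P := (J :* (J :* J)) :* ((J :* J) :* (J :* J)) :* (P :* E)) refl P E ⟩
      (let J = E * (E * E) in (J * (J * J)) * ((J * J) * (J * J)) * (P * E))
        ≈⟨ *-cong (*-cong (*-cong E³≈J (*-cong E³≈J E³≈J)) (*-cong (*-cong E³≈J E³≈J) (*-cong E³≈J E³≈J))) PE≈1 ⟩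
      (J * (J * J)) * ((J * J) * (J * J)) * 1#  ≈⟨ *-identityʳ _ ⟩
      (J * (J * J)) * ((J * J) * (J * J))       ∎

    E¹²≈J⁴ : E ^ 11 * E ≈ (J * J) * (J * J)
    E¹²≈J⁴ = trans
      (solve 1 (λ E → let J = E :* (E :* E) in E :^ 11 :* E := (J :* J) :* (J :* J)) refl E)
      (*-cong (*-cong E³≈J E³≈J) (*-cong E³≈J E³≈J))

  module _ (q : Carrier) (p : ℕ) (frobenius : ∀ x → (1# - x) ^ p ≈ 1# - x ^ p) where
    open QSums R q using (eulerProduct)

    eulerProduct-^ : ∀ n → eulerProduct (q ^ p) n ≈ eulerProduct q n ^ p
    eulerProduct-^ zero    = sym (1^n≈1 p)
    eulerProduct-^ (suc n) = begin
      eulerProduct (q ^ p) n * (1# - (q ^ p) ^ suc n)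
        ≈⟨ *-cong (eulerProduct-^ n) (+-congˡ (-‿cong q^pn)) ⟩
      eulerProduct q n ^ p * (1# - (q ^ suc n) ^ p)
        ≈⟨ *-congˡ (frobenius (q ^ suc n)) ⟨
      eulerProduct q n ^ p * (1# - q ^ suc n) ^ p
        ≈⟨ ^-distrib-* _ _ p ⟨
      (eulerProduct q n * (1# - q ^ suc n)) ^ p  ∎
      where
      q^pn : (q ^ p) ^ suc n ≈ (q ^ suc n) ^ p
      q^pn = trans (^-assocʳ q p (suc n))
        (trans (^-congʳ q (ℕ.*-comm p (suc n))) (sym (^-assocʳ q (suc n) p)))

  module _ (q : Carrier) where
    open QSums R q using (odd)

    odd≈ : ∀ k → odd k ≈ ⟦ + (1 ℕ.+ (k ℕ.+ k)) ⟧
    odd≈ zero    = sym 1-homo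
    odd≈ (suc k) = begin
      odd k + (1# + 1#)  ≈⟨ +-cong (odd≈ k) (sym (trans (+-homo (+ 1) (+ 1)) (+-cong 1-homo 1-homo))) ⟩
      ⟦ + (1 ℕ.+ (k ℕ.+ k)) ⟧ + ⟦ + 2 ⟧  ≈⟨ +-homo (+ (1 ℕ.+ (k ℕ.+ k))) (+ 2) ⟨
      ⟦ + (1 ℕ.+ (k ℕ.+ k) ℕ.+ 2) ⟧
        ≈⟨ reflexive (≡.cong (λ n → ⟦ + n ⟧)
             (≡.trans (ℕ.+-comm _ 2) (≡.cong (λ n → 2 ℕ.+ n) (≡.sym (ℕ.+-suc k k))))) ⟩
      ⟦ + (1 ℕ.+ (suc k ℕ.+ suc k)) ⟧  ∎

  multiple≈0 : ∀ {p} n → ⟦ + suc p ⟧ ≈ 0# → n % suc p ≡ 0 → ⟦ + n ⟧ ≈ 0#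
  multiple≈0 {p} n p≈0 n%p≡0 = begin
    ⟦ + n ⟧
      ≈⟨ reflexive (≡.cong (λ n → ⟦ + n ⟧) (≡.trans (m≡m%n+[m/n]*n n (suc p))
           (≡.cong (ℕ._+ n / suc p ℕ.* suc p) n%p≡0))) ⟩
    ⟦ + (n / suc p ℕ.* suc p) ⟧         ≈⟨ reflexive (≡.cong ⟦_⟧ (ℤ.pos-* (n / suc p) (suc p))) ⟩
    ⟦ + (n / suc p) ℤ.* + suc p ⟧       ≈⟨ *-homo _ _ ⟩
    ⟦ + (n / suc p) ⟧ * ⟦ + suc p ⟧     ≈⟨ trans (*-congˡ p≈0) (zeroʳ _) ⟩
    0#                                  ∎

-- Generating functions of partitions and of occurrences

module GeneratingFunctions
  (K : CommutativeRing 0ℓ 0ℓ)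
  (κ : ℤ⟶ K)
  (N k-1 : ℕ)
  where

  private
    module K = CommutativeRing K
    module κ = _-Raw-AlmostCommutative⟶_ κ
    k = suc k-1
  open Truncated K N
  open CommutativeRing seriesRing hiding (zero)
  open QSums seriesRing q
  open SetoidReasoning setoid
  module E = Elementary seriesRing (constants κ)

  series : (List ℕ → ℕ) → ℕ → Series
  series w b n = κ.⟦ + total w b n ⟧

  count occ : ℕ → Series
  count = series (λ _ → 1)
  occ   = series (occurrences k)

  private
    κ-reflexive : ∀ {m n} → m ≡ n → κ.⟦ + m ⟧ K.≈ κ.⟦ + n ⟧
    κ-reflexive eq = K.reflexive (≡.cong (λ n → κ.⟦ + n ⟧) eq)

  series-suc : ∀ w b → series w (suc b) ≋ series w b + q ^ suc b * series (λ ps → w (suc b ∷ ps)) (suc b)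
  series-suc w b n n<N with n ℕ.≤? b
  ... | yes n≤b = K.trans (κ-reflexive (total-suc-below w n≤b))
    (K.sym (K.trans (K.+-congˡ (q^⊛-below (suc b) _ n n<N (s≤s n≤b))) (K.+-identityʳ _)))
  ... | no  n≰b = ≡.subst (λ n → n < N → series w (suc b) n K.≈ (series w b + q ^ suc b * tail) n)
                    (ℕ.m+[n∸m]≡n (ℕ.≰⇒> n≰b)) (above (n ℕ.∸ suc b)) n<N
    where
    tail : Series
    tail = series (λ ps → w (suc b ∷ ps)) (suc b)
    above : ∀ m → suc b ℕ.+ m < N →
            series w (suc b) (suc b ℕ.+ m) K.≈ (series w b + q ^ suc b * tail) (suc b ℕ.+ m)
    above m m<N = K.trans (κ-reflexive (total-suc-above w b m))
      (K.trans (κ.+-homo (+ total w b (suc b ℕ.+ m)) (+ total (λ ps → w (suc b ∷ ps)) (suc b) m))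
        (K.+-congˡ (K.sym (q^⊛-above (suc b) tail m m<N))))

  series-cong : ∀ {v w} b → (∀ ps → v ps ≡ w ps) → series v b ≋ series w b
  series-cong b v≗w n _ = κ-reflexive (total-cong b n v≗w)

  count-zero : count 0 ≋ 1#
  count-zero zero    _ = κ.1-homo
  count-zero (suc n) _ = K.trans (κ-reflexive (≡.cong (λ pss → sum (map (λ _ → 1) pss)) (bounded-zero n)))
    κ.0-homo

  occ-zero : occ 0 ≋ 0#
  occ-zero zero    _ = κ.0-homo
  occ-zero (suc n) _ = K.trans (κ-reflexive (≡.cong (λ pss → sum (map (occurrences k) pss)) (bounded-zero n)))
    κ.0-homo

  count-suc : ∀ b → count (suc b) * (1# - q ^ suc b) ≋ count b
  count-suc b = E.geometric (q ^ suc b) (series-suc (λ _ → 1) b)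

  occ-suc-≢ : ∀ b → k ≢ suc b → occ (suc b) * (1# - q ^ suc b) ≋ occ b
  occ-suc-≢ b k≢1+b = E.geometric (q ^ suc b) (trans (series-suc (occurrences k) b)
    (+-congˡ (*-congˡ (series-cong (suc b) (λ ps → occurrences-∷-≢ ps k≢1+b)))))

  occ-suc-≡ : occ k * (1# - q ^ k) ≋ occ k-1 + q ^ k * count k
  occ-suc-≡ = E.geometric (q ^ k) (begin
    occ k
      ≈⟨ series-suc (occurrences k) k-1 ⟩
    occ k-1 + q ^ k * series (λ ps → occurrences k (k ∷ ps)) k
      ≈⟨ +-congˡ (*-congˡ (trans (series-cong k (occurrences-∷-≡ k)) split)) ⟩
    occ k-1 + q ^ k * (count k + occ k)
      ≈⟨ trans (+-congˡ (distribˡ (q ^ k) _ _)) (sym (+-assoc _ _ _)) ⟩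
    occ k-1 + q ^ k * count k + q ^ k * occ k  ∎)
    where
    split : series (λ ps → 1 ℕ.+ occurrences k ps) k ≋ count k + occ k
    split n _ = K.trans (κ-reflexive (total-+ (λ _ → 1) (occurrences k) k n))
      (κ.+-homo (+ total (λ _ → 1) k n) (+ total (occurrences k) k n))

  count*eulerProduct : ∀ b → count b * eulerProduct q b ≋ 1#
  count*eulerProduct zero    = trans (*-identityʳ (count 0)) count-zero
  count*eulerProduct (suc b) = begin
    count (suc b) * (eulerProduct q b * (1# - q ^ suc b))
      ≈⟨ E.swap (count (suc b)) (eulerProduct q b) (1# - q ^ suc b) ⟩
    count (suc b) * (1# - q ^ suc b) * eulerProduct q b
      ≈⟨ *-congʳ (count-suc b) ⟩
    count b * eulerProduct q b
      ≈⟨ count*eulerProduct b ⟩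
    1#  ∎

  occ*eulerProduct-below : ∀ b → b < k → occ b * eulerProduct q b ≋ 0#
  occ*eulerProduct-below zero    _   = trans (*-congʳ occ-zero) (zeroˡ (eulerProduct q 0))
  occ*eulerProduct-below (suc b) b<k = begin
    occ (suc b) * (eulerProduct q b * (1# - q ^ suc b))
      ≈⟨ E.swap (occ (suc b)) (eulerProduct q b) (1# - q ^ suc b) ⟩
    occ (suc b) * (1# - q ^ suc b) * eulerProduct q b
      ≈⟨ *-congʳ (occ-suc-≢ b (≡.≢-sym (ℕ.<⇒≢ b<k))) ⟩
    occ b * eulerProduct q b
      ≈⟨ occ*eulerProduct-below b (ℕ.<-trans (ℕ.n<1+n b) b<k) ⟩
    0#  ∎

  -- The series of occurrences is q^k / (1 - q^k) times that of the partitions. The extra factor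
  -- arises at the bound `k`, where putting a `k` in front adds an occurrence; every later bound
  -- contributes the same factor to both series.
  occ*eulerProduct-above : ∀ j → occ (j ℕ.+ k) * eulerProduct q (j ℕ.+ k) * (1# - q ^ k) ≋ q ^ k
  occ*eulerProduct-above zero = begin
    occ k * (E′ * (1# - q ^ k)) * (1# - q ^ k)
      ≈⟨ *-congʳ (E.swap (occ k) E′ (1# - q ^ k)) ⟩
    occ k * (1# - q ^ k) * E′ * (1# - q ^ k)
      ≈⟨ *-congʳ (*-congʳ occ-suc-≡) ⟩
    (occ k-1 + q ^ k * count k) * E′ * (1# - q ^ k)
      ≈⟨ *-congʳ (trans (distribʳ E′ _ _) (trans (+-congʳ (occ*eulerProduct-below k-1 (ℕ.n<1+n k-1)))
           (+-identityˡ _))) ⟩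
    q ^ k * count k * E′ * (1# - q ^ k)
      ≈⟨ trans (*-assoc _ E′ (1# - q ^ k)) (*-assoc (q ^ k) (count k) _) ⟩
    q ^ k * (count k * (E′ * (1# - q ^ k)))
      ≈⟨ *-congˡ (count*eulerProduct k) ⟩
    q ^ k * 1#  ≈⟨ *-identityʳ (q ^ k) ⟩
    q ^ k       ∎
    where E′ = eulerProduct q k-1
  occ*eulerProduct-above (suc j) = begin
    occ (suc b) * (eulerProduct q b * (1# - q ^ suc b)) * (1# - q ^ k)
      ≈⟨ *-congʳ (E.swap (occ (suc b)) (eulerProduct q b) (1# - q ^ suc b)) ⟩
    occ (suc b) * (1# - q ^ suc b) * eulerProduct q b * (1# - q ^ k)
      ≈⟨ *-congʳ (*-congʳ (occ-suc-≢ b (ℕ.<⇒≢ (s≤s (ℕ.m≤n+m k j))))) ⟩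
    occ b * eulerProduct q b * (1# - q ^ k)
      ≈⟨ occ*eulerProduct-above j ⟩
    q ^ k  ∎
    where b = j ℕ.+ k

  occ-recurrence : ∀ j → occ (j ℕ.+ k) ≋ q ^ k * (occ (j ℕ.+ k) + count (j ℕ.+ k))
  occ-recurrence j = E.ungeometric (q ^ k) (count*eulerProduct (j ℕ.+ k)) (occ*eulerProduct-above j)

  occ≈Q : ∀ {b n} → n ≤ b → occ b n K.≈ κ.⟦ + Q k n ⟧
  occ≈Q n≤b = κ-reflexive (≡.cong (λ pss → sum (map (occurrences k) pss)) (bounded-all n≤b))

-- Triangular and pentagonal exponents modulo p

quadratic : ℕ → ℕ → ℕ → ℕ
quadratic c d zero    = 0
quadratic c d (suc k) = c ℕ.* k ℕ.+ d ℕ.+ quadratic c d k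

-- `quadratic 1 1 k` is k(k+1)/2 and `quadratic 3 2 k` is k(3k+1)/2, written as sums of increments
-- to avoid halving. For `n = p` the cross term is a multiple of p, so the exponents are periodic
-- modulo p once p divides the value at p.
quadratic-+ : ∀ c d n k →
  quadratic c d (n ℕ.+ k) ≡ quadratic c d k ℕ.+ quadratic c d n ℕ.+ c ℕ.* k ℕ.* n
quadratic-+ c d zero    k = solve 3 (λ c k f → f := f :+ con 0 :+ c :* k :* con 0) ≡.refl c k (quadratic c d k)
  where open +-*-Solver
quadratic-+ c d (suc n) k = ≡.trans (≡.cong (c ℕ.* (n ℕ.+ k) ℕ.+ d ℕ.+_) (quadratic-+ c d n k))
  (solve 6 (λ c d n k f g → c :* (n :+ k) :+ d :+ (f :+ g :+ c :* k :* n)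
                         := f :+ (c :* n :+ d :+ g) :+ c :* k :* (con 1 :+ n))
    ≡.refl c d n k (quadratic c d k) (quadratic c d n))
  where open +-*-Solver

module Periodicity (p-1 : ℕ) where

  open Congruence p-1

  periodic : (f : ℕ → ℕ) → (∀ k → f (p ℕ.+ k) ≡ₘ f k) → ∀ k → f k ≡ₘ f (k % p)
  periodic f step k = ≡.subst (λ n → f n ≡ₘ f (k % p))
    (≡.sym (≡.trans (m≡m%n+[m/n]*n k p) (ℕ.+-comm (k % p) _))) (go (k / p))
    where
    go : ∀ m → f (m ℕ.* p ℕ.+ k % p) ≡ₘ f (k % p)
    go zero    = ≡ₘ-refl (f (k % p))
    go (suc m) = ≡ₘ-trans
      (≡.subst (λ n → f n ≡ₘ f (m ℕ.* p ℕ.+ k % p)) (≡.sym (ℕ.+-assoc p (m ℕ.* p) (k % p)))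
        (step (m ℕ.* p ℕ.+ k % p)))
      (go m)

  quadratic-periodic : ∀ c d → quadratic c d p ≡ₘ 0 → ∀ k → quadratic c d k ≡ₘ quadratic c d (k % p)
  quadratic-periodic c d f[p]≡0 = periodic (quadratic c d) λ k →
    ≡ₘ-trans (mod (≡.trans (≡.cong (_% p) (quadratic-+ c d p k))
      ([m+kn]%n≡m%n (quadratic c d k ℕ.+ quadratic c d p) (c ℕ.* k) p)))
      (≡.subst (quadratic c d k ℕ.+ quadratic c d p ≡ₘ_) (ℕ.+-identityʳ (quadratic c d k))
        (+-cong-≡ₘ (≡ₘ-refl (quadratic c d k)) f[p]≡0))

-- From missing classes of partitions to the vanishing of Q

module Assembly
  (K : CommutativeRing 0ℓ 0ℓ)
  (κ : ℤ⟶ K)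
  (p-1 N : ℕ)
  (p≈0 : Kills κ (suc p-1))
  where

  open Dissection K p-1 N
  open Periodicity p-1
  private
    module K = CommutativeRing K
    module κ = _-Raw-AlmostCommutative⟶_ κ

  ι : ℤ⟶ seriesRing
  ι = constants κ

  private
    module ι = _-Raw-AlmostCommutative⟶_ ι
    module El = Elementary seriesRing ι
    module GF = GeneratingFunctions K κ N p-1

  p≋0 : ι.⟦ + p ⟧ ≋ 0#
  p≋0 zero    _ = p≈0
  p≋0 (suc n) _ = K.refl

  -- The bound `N + p` of `P` has the form `j + k` asked for by `occ-recurrence`, and it exceeds all
  -- exponents below `N`, so no partition is lost.
  E P J : Series
  E = eulerProduct q N
  P = GF.count (N ℕ.+ p)
  J = jacobiSum N

  PE≋1 : P * E ≋ 1#
  PE≋1 = trans (*-congˡ (sym (trans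
      (reflexive (≡.cong (eulerProduct q) (ℕ.+-comm N p)))
      (QSeries.eulerProduct-stable seriesRing ι q {N} q^N≋0 p))))
    (GF.count*eulerProduct (N ℕ.+ p))

  E³≋J : E * (E * E) ≋ J
  E³≋J = QSeries.jacobi seriesRing ι q {N} q^N≋0 {P} PE≋1

  supported-≡ : ∀ {r s f} → r ≡ s → Supported r f → Supported s f
  supported-≡ {f = f} r≡s = ≡.subst (λ t → Supported t f) r≡s

  supported-≡ₘ : ∀ {r s f} → r ≡ₘ s → Supported r f → Supported s f
  supported-≡ₘ r≡s f-supp = supported λ n n<N n≢s →
    elsewhere f-supp n n<N (λ n≡r → n≢s (≡ₘ-trans n≡r r≡s))

  supported-^ : ∀ {f} n → Supported 0 f → Supported 0 (f ^ n)
  supported-^ zero    f-supp = supported-1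
  supported-^ (suc n) f-supp = supported-* f-supp (supported-^ n f-supp)

  supported-eulerProduct : ∀ {f} n → Supported 0 f → Supported 0 (eulerProduct f n)
  supported-eulerProduct zero    f-supp = supported-1
  supported-eulerProduct (suc n) f-supp = supported-* (supported-eulerProduct n f-supp)
    (supported-+ supported-1 (supported-neg (supported-^ (suc n) f-supp)))

  supported-odd : ∀ k → Supported 0 (odd k)
  supported-odd zero    = supported-1
  supported-odd (suc k) = supported-+ (supported-odd k) (supported-+ supported-1 supported-1)

  supported-alternating : ∀ k → Supported (quadratic 1 1 k) (alternating k)
  supported-alternating zero    = supported-1
  supported-alternating (suc k) = supported-neg (supported-≡
    (≡.cong (ℕ._+ quadratic 1 1 k) (solve 1 (λ k → con 1 :+ k := con 1 :* k :+ con 1) ≡.refl k))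
    (supported-* (supported-q^ (suc k)) (supported-alternating k)))
    where open +-*-Solver

  supported-pentagonal : ∀ k → Supported (quadratic 3 2 k) (pentagonal k)
  supported-pentagonal zero    = supported-1
  supported-pentagonal (suc k) = supported-neg (supported-≡
    (≡.cong (ℕ._+ quadratic 3 2 k) (solve 1 (λ k → k :+ k :+ k :+ con 2 := con 3 :* k :+ con 2) ≡.refl k))
    (supported-* (supported-* (supported-* (supported-* (supported-q^ k) (supported-q^ k)) (supported-q^ k))
      (supported-* supported-q supported-q)) (supported-pentagonal k)))
    where open +-*-Solver

  missing-∉ : ∀ {rs r s f} → r % p ∈ rs → s ≤ p-1 → ¬ s ∈ rs → Supported r f → Missing s f
  missing-∉ {rs} r∈ s≤p-1 s∉ f-supp = supported⇒missing f-supp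
    (λ s≡r → s∉ (≡.subst (_∈ rs) (≡.trans (≡.sym (residues s≡r)) (m<n⇒m%n≡m (s≤s s≤p-1))) r∈))

  -- Both the class of the exponent k(k+1)/2 and the divisibility of 2k + 1 by p depend only on k
  -- modulo p, so `k < p` suffices as a finite check.
  J-missing : ∀ rs → quadratic 1 1 p ≡ₘ 0 →
    (∀ {k} → k < p → quadratic 1 1 k % p ∈ rs ⊎ (1 ℕ.+ (k ℕ.+ k)) % p ≡ 0) →
    ∀ s → s ≤ p-1 → ¬ s ∈ rs → Missing s J
  J-missing rs T[p]≡0 classes s s≤p-1 s∉ = missing-∑ N term
    where
    term : ∀ k → Missing s (odd k * alternating k)
    term k with classes (m%n<n k p)
    ... | inj₁ T∈ = missing-∉ {rs} (≡.subst (_∈ rs) (≡.sym (residues (quadratic-periodic 1 1 T[p]≡0 k))) T∈) s≤p-1 s∉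
                      (supported-* (supported-odd k) (supported-alternating k))
    ... | inj₂ 1+2k≡0 = missing-0 (trans (*-congʳ (trans (El.odd≈ q k)
      (El.multiple≈0 _ p≋0 (≡.trans
        (≡.sym (residues (+-cong-≡ₘ (≡ₘ-refl 1) (+-cong-≡ₘ (%-≡ₘ k) (%-≡ₘ k))))) 1+2k≡0))))
      (zeroˡ (alternating k)))

  -- The second sum in the hypothesis, 2k + 1 + k(3k+1)/2 = (k+1)(3k+2)/2, is the exponent of the
  -- term of index -(k + 1). As for J, residues of k are enough.
  E-missing : ∀ rs → 0 ∈ rs → quadratic 3 2 p ≡ₘ 0 →
    (∀ {k} → k < p → quadratic 3 2 k % p ∈ rs × (k ℕ.+ k ℕ.+ 1 ℕ.+ quadratic 3 2 k) % p ∈ rs) →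
    ∀ s → s ≤ p-1 → ¬ s ∈ rs → Missing s E
  E-missing rs 0∈rs g[p]≡0 classes s s≤p-1 s∉ =
    missing-cong (sym (QSeries.euler seriesRing ι q {N} q^N≋0)) (missing-∑ N term)
    where
    periodic-g : ∀ k → quadratic 3 2 k ≡ₘ quadratic 3 2 (k % p)
    periodic-g = quadratic-periodic 3 2 g[p]≡0
    g∈ : ∀ k → quadratic 3 2 k % p ∈ rs
    g∈ k = ≡.subst (_∈ rs) (≡.sym (residues (periodic-g k))) (proj₁ (classes (m%n<n k p)))
    g∈′ : ∀ k → (k ℕ.+ k ℕ.+ 1 ℕ.+ quadratic 3 2 k) % p ∈ rs
    g∈′ k = ≡.subst (_∈ rs) (residues (+-cong-≡ₘ
        (+-cong-≡ₘ (+-cong-≡ₘ (%-≡ₘ k) (%-≡ₘ k)) (≡ₘ-refl 1)) (≡ₘ-sym (periodic-g k))))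
      (proj₂ (classes (m%n<n k p)))
    term : ∀ k → Missing s (pentagonalPair k)
    term zero    = missing-∉ {rs} {0} 0∈rs s≤p-1 s∉ supported-1
    term (suc k) = missing-+ (missing-∉ {rs} (g∈ (suc k)) s≤p-1 s∉ (supported-pentagonal (suc k)))
      (missing-∉ {rs} (g∈′ k) s≤p-1 s∉ (supported-neg (supported-*
        (supported-* (supported-* (supported-q^ k) (supported-q^ k)) supported-q) (supported-pentagonal k))))

  sparse-components : ∀ f rs s → (¬ s ∈ rs → Missing s f) →
    component s f ≋ sparse ι.⟦ + 0 ⟧ (map (λ r → r , component r f) rs) s
  sparse-components f []       s f-missing =
    trans (missing⇒component≋0 (f-missing λ ())) (sym ι.0-homo)
  sparse-components f (r ∷ rs) s f-missing with s ≡ᵇ r in eq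
  ... | true  = reflexive (≡.cong (λ r → component r f) (ℕ.≡ᵇ⇒≡ s r (≡.subst T (≡.sym eq) tt)))
  ... | false = sparse-components f rs s λ s∉rs → f-missing λ
    { (here s≡r)   → ≡.subst T eq (ℕ.≡⇒≡ᵇ s r s≡r)
    ; (there s∈rs) → s∉rs s∈rs }

  module _ (frobenius : ∀ x → (1# - x) ^ p ≋ 1# - x ^ p) where

    -- Taken as a product in q^p, not as a power of `E`, so that its support is visible; Frobenius,
    -- applied to each factor, identifies it with `E ^ p`.
    F : Series
    F = eulerProduct (q ^ p) N

    F≋E^p : F ≋ E ^ p
    F≋E^p = El.eulerProduct-^ q p frobenius N

    F-supported : Supported 0 F
    F-supported = supported-eulerProduct N (supported-≡ₘ (mod ([m+n]%n≡m%n 0 p)) (supported-q^ p))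

    P^pF≋1 : P ^ p * F ≋ 1#
    P^pF≋1 = trans (*-congˡ F≋E^p) (El.^-inverse p PE≋1)

  -- Unrolled in steps of p, the recurrence expresses the value at t + n p as the sum of the
  -- partition numbers at t + i p with i < n, all in the class `t`. It starts from 0 because `t < p`
  -- leaves no room for a part p.
  Q-vanishes : ∀ {t} n → t < p → Missing t P → t ℕ.+ n ℕ.* p < N → κ.⟦ + Q p (t ℕ.+ n ℕ.* p) ⟧ K.≈ K.0#
  Q-vanishes {t} n t<p P-missing m<N =
    K.trans (K.sym (GF.occ≈Q (ℕ.≤-trans (ℕ.<⇒≤ m<N) (ℕ.m≤m+n N p)))) (go n m<N)
    where
    G : Series
    G = GF.occ (N ℕ.+ p)
    go : ∀ n → t ℕ.+ n ℕ.* p < N → G (t ℕ.+ n ℕ.* p) K.≈ K.0#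
    go zero m<N = K.trans (GF.occ-recurrence N _ m<N)
      (q^⊛-below p (G + P) (t ℕ.+ 0) m<N (≡.subst (_< p) (≡.sym (ℕ.+-identityʳ t)) t<p))
    go (suc n) m<N = ≡.subst (λ m → G m K.≈ K.0#) (≡.sym t+[p+np])
      (K.trans (GF.occ-recurrence N _ m<N′)
      (K.trans (q^⊛-above p (G + P) (t ℕ.+ n ℕ.* p) m<N′)
        (K.trans (K.+-cong (go n m<N″) (vanishing P-missing _ m<N″ (mod ([m+kn]%n≡m%n t n p))))
          (K.+-identityˡ K.0#))))
      where
      open +-*-Solver
      t+[p+np] : t ℕ.+ (p ℕ.+ n ℕ.* p) ≡ p ℕ.+ (t ℕ.+ n ℕ.* p)
      t+[p+np] = solve 3 (λ t p np → t :+ (p :+ np) := p :+ (t :+ np)) ≡.refl t p (n ℕ.* p)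
      m<N′ : p ℕ.+ (t ℕ.+ n ℕ.* p) < N
      m<N′ = ≡.subst (_< N) t+[p+np] m<N
      m<N″ : t ℕ.+ n ℕ.* p < N
      m<N″ = ℕ.≤-<-trans (ℕ.m≤n+m _ p) m<N′

-- The primes 5, 7 and 11

module _
  (K : CommutativeRing 0ℓ 0ℓ)
  (κ : ℤ⟶ K)
  (N : ℕ)
  where

  module Mod₅ (p≈0 : Kills κ 5) where
    open Dissection K 4 N
    open Assembly K κ 4 N p≈0

    J³-missing : Missing 4 (J * (J * J))
    J³-missing = component≋0⇒missing (trans
      (component-* 4 J (J * J))
      (Certificate₅.cube seriesRing ι p≋0 J≋ (λ s → component-* s J J)))
      where
      rs : List ℕ
      rs = 0 ∷ 1 ∷ []
      J≋ : ∀ s → s ≤ 4 → component s J ≋ sparse _ (map (λ r → r , component r J) rs) s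
      J≋ s s≤4 = sparse-components J rs s (J-missing rs (mod ≡.refl)
        (from-yes (ℕ.allUpTo? (λ k → (quadratic 1 1 k % 5 ∈? rs)
          ⊎-dec ((1 ℕ.+ (k ℕ.+ k)) % 5 ℕ.≟ 0)) 5)) s s≤4)

    -- Two factors `F` are needed, since m = 2 is the least m for which 5m - 1 is a multiple of 3:
    -- E¹⁰ P = E⁹ = J³. For 7 and 11 the same rule gives m = 1 with E⁶ = J², and m = 2 with E²¹ =
    -- J⁷.
    P-missing : Missing 4 P
    P-missing = missing-unit* (F φ * F φ) (P ^ 5 * P ^ 5) P
      (supported-* (F-supported φ) (F-supported φ))
      (Elementary.*-inverse² seriesRing ι {P ^ 5} {F φ} (P^pF≋1 φ))
      (missing-cong (sym (trans (*-congʳ (*-cong (F≋E^p φ) (F≋E^p φ)))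
        (Elementary.E¹⁰P≈J³ seriesRing ι {P} {E} {J} PE≋1 E³≋J))) J³-missing)
      where φ = Certificate₅.frobenius seriesRing ι p≋0

  module Mod₇ (p≈0 : Kills κ 7) where
    open Dissection K 6 N
    open Assembly K κ 6 N p≈0

    J²-missing : Missing 5 (J * J)
    J²-missing = component≋0⇒missing (trans
      (component-* 5 J J)
      (Certificate₇.square seriesRing ι p≋0 J≋))
      where
      rs : List ℕ
      rs = 0 ∷ 1 ∷ 3 ∷ []
      J≋ : ∀ s → s ≤ 6 → component s J ≋ sparse _ (map (λ r → r , component r J) rs) s
      J≋ s s≤6 = sparse-components J rs s (J-missing rs (mod ≡.refl)
        (from-yes (ℕ.allUpTo? (λ k → (quadratic 1 1 k % 7 ∈? rs)
          ⊎-dec ((1 ℕ.+ (k ℕ.+ k)) % 7 ℕ.≟ 0)) 7)) s s≤6)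

    P-missing : Missing 5 P
    P-missing = missing-unit* (F φ) (P ^ 7) P (F-supported φ) (P^pF≋1 φ)
      (missing-cong (sym (trans (*-congʳ (F≋E^p φ))
        (Elementary.E⁷P≈J² seriesRing ι {P} {E} {J} PE≋1 E³≋J))) J²-missing)
      where φ = Certificate₇.frobenius seriesRing ι p≋0

  module Mod₁₁ (p≈0 : Kills κ 11) where
    open Dissection K 10 N
    open Assembly K κ 10 N p≈0

    φ : ∀ x → (1# - x) ^ 11 ≋ 1# - x ^ 11
    φ = Certificate₁₁.frobenius seriesRing ι p≋0

    J⁴-missing : ∀ s → s ≤ 10 → ¬ s ∈ 0 ∷ 1 ∷ 2 ∷ 4 ∷ 5 ∷ 7 ∷ [] → Missing s ((J * J) * (J * J))
    J⁴-missing s s≤10 s∉ = missing-cong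
      (trans (*-congʳ (F≋E^p φ)) (Elementary.E¹²≈J⁴ seriesRing ι {P} {E} {J} PE≋1 E³≋J))
      (missing-*ˡ (F φ) E (F-supported φ) (E-missing rs (here ≡.refl) (mod ≡.refl)
        (from-yes (ℕ.allUpTo? (λ k → (quadratic 3 2 k % 11 ∈? rs) ×-dec
          ((k ℕ.+ k ℕ.+ 1 ℕ.+ quadratic 3 2 k) % 11 ∈? rs)) 11)) s s≤10 s∉))
      where
      rs : List ℕ
      rs = 0 ∷ 1 ∷ 2 ∷ 4 ∷ 5 ∷ 7 ∷ []

    J⁷-missing : Missing 6 ((J * (J * J)) * ((J * J) * (J * J)))
    J⁷-missing = component≋0⇒missing (trans
      (component-* 6 (J * (J * J)) ((J * J) * (J * J)))
      (Certificate₁₁.seventhPower seriesRing ι p≋0 J≋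
        (λ s → component-* s J J) (λ s → component-* s J (J * J)) (λ s → component-* s (J * J) (J * J))
        (absent 3) (absent 6) (absent 8) (absent 9) (absent 10)))
      where
      rs : List ℕ
      rs = 0 ∷ 1 ∷ 3 ∷ 6 ∷ 10 ∷ []
      J≋ : ∀ s → s ≤ 10 → component s J ≋ sparse _ (map (λ r → r , component r J) rs) s
      J≋ s s≤10 = sparse-components J rs s (J-missing rs (mod ≡.refl)
        (from-yes (ℕ.allUpTo? (λ k → (quadratic 1 1 k % 11 ∈? rs)
          ⊎-dec ((1 ℕ.+ (k ℕ.+ k)) % 11 ℕ.≟ 0)) 11)) s s≤10)
      absent : ∀ s → {s≤10 : True (s ℕ.≤? 10)} {s∉ : False (s ∈? 0 ∷ 1 ∷ 2 ∷ 4 ∷ 5 ∷ 7 ∷ [])} →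
               component s ((J * J) * (J * J)) ≋ 0#
      absent s {s≤10} {s∉} = missing⇒component≋0 (J⁴-missing s (toWitness s≤10) (toWitnessFalse s∉))

    P-missing : Missing 6 P
    P-missing = missing-unit* (F φ * F φ) (P ^ 11 * P ^ 11) P
      (supported-* (F-supported φ) (F-supported φ))
      (Elementary.*-inverse² seriesRing ι {P ^ 11} {F φ} (P^pF≋1 φ))
      (missing-cong (sym (trans (*-congʳ (*-cong (F≋E^p φ) (F≋E^p φ)))
        (Elementary.E²²P≈J⁷ seriesRing ι {P} {E} {J} PE≋1 E³≋J))) J⁷-missing)

divides-Q : ∀ {p} t n → Residues._≈ₚ_ p (+ Q p (t ℕ.+ n ℕ.* p)) (+ 0) → p ∣ Q p (p ℕ.* n ℕ.+ t)
divides-Q {p} t n (Residues.congruent p∣Q) = ≡.subst (λ m → p ∣ Q p m)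
  (≡.trans (ℕ.+-comm t (n ℕ.* p)) (≡.cong (ℕ._+ t) (ℕ.*-comm n p)))
  (∣⇒∣ᵤ (≡.subst (ℤ∣._∣_ (+ p)) (ℤ.+-identityʳ (+ Q p (t ℕ.+ n ℕ.* p))) p∣Q))

open import Data.Nat using (_+_; _*_)

theorem3 : (n : ℕ) →
    (5 ∣ Q 5 (5 * n + 4)) × (7 ∣ Q 7 (7 * n + 5)) × (11 ∣ Q 11 (11 * n + 6))
theorem3 n =
    divides-Q 4 n (Assembly.Q-vanishes K₅ κ₅ 4 N₅ p₅ n (ℕ.≤ᵇ⇒≤ 5 5 tt)
        (Mod₅.P-missing K₅ κ₅ N₅ p₅) (ℕ.n<1+n _))
  , divides-Q 5 n (Assembly.Q-vanishes K₇ κ₇ 6 N₇ p₇ n (ℕ.≤ᵇ⇒≤ 6 7 tt)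
        (Mod₇.P-missing K₇ κ₇ N₇ p₇) (ℕ.n<1+n _))
  , divides-Q 6 n (Assembly.Q-vanishes K₁₁ κ₁₁ 10 N₁₁ p₁₁ n (ℕ.≤ᵇ⇒≤ 7 11 tt)
        (Mod₁₁.P-missing K₁₁ κ₁₁ N₁₁ p₁₁) (ℕ.n<1+n _))
  where
  open Residues 5 using () renaming (ℤ/p to K₅; integers to κ₅; p≈0 to p₅)
  open Residues 7 using () renaming (ℤ/p to K₇; integers to κ₇; p≈0 to p₇)
  open Residues 11 using () renaming (ℤ/p to K₁₁; integers to κ₁₁; p≈0 to p₁₁)
  -- One more than the exponent in question: the least truncation order that keeps its coefficient.
  N₅  = suc (4 + n * 5)
  N₇  = suc (5 + n * 7)
  N₁₁ = suc (6 + n * 11)
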